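{- Let $F$ be a minimally unsatisfiable clause-set which is eventually saturated, i.e., every element of $\mathrm{sDP}(F)$ is saturated. Then singular DP-reduction is confluent modulo isomorphism on $F$: any two elements $F', F'' \in \mathrm{sDP}(F)$ are isomorphic.
   Context: Literals are variables $v$ and complements $\overline{v}$; a clause is a finite set of literals with no complementary pair; a clause-set is a finite set of clauses; $\mathrm{var}(F)$ is the set of variables of $F$; $\mathrm{ldeg}_F(x)$ is the number of clauses of $F$ containing literal $x$. $\mathrm{DP}_v(F) := \{C \in F : v \notin \mathrm{var}(C)\} \cup \{(C \cup D)\setminus\{v,\overline{v}\} : C, D \in F,\ C \cap \overline{D} = \{v\}\}$. $\mathrm{MU}$ is the set of minimally unsatisfiable clause-sets. $F\in\mathrm{MU}$ is saturated if for every $C \in F$ and every literal $x$ with $\mathrm{var}(x) \in \mathrm{var}(F)\setminus \mathrm{var}(C)$, the clause-set $(F\setminus\{C\})\cup\{C\cup\{x\}\}$ is satisfiable. A variable $v$ is singular for $F$ if $\min(\mathrm{ldeg}_F(v),\mathrm{ldeg}_F(\overline{v}))=1$; $F$ is nonsingular if it has none. A singular DP-reduction step is $F\leadsto \mathrm{DP}_v(F)$ for $F\in\mathrm{MU}$ and $v$ singular for $F$. $\mathrm{sDP}(F)$ is the set of nonsingular $F'\in\mathrm{MU}$ obtainable from $F$ by zero or more singular DP-reduction steps. Clause-sets $F,G$ are isomorphic if there is a bijection on literals commuting with complementation that maps the clauses of $F$ exactly onto the clauses of $G$. -}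

module Defs where

open import Data.Bool.Base using (Bool; true; not)
open import Data.List.Base
  using (List; []; _∷_; [_]; _++_; map; concatMap; filter; mapMaybe; deduplicate; cartesianProduct; length)
open import Data.List.Membership.Propositional.Properties
  using (∈-map⁺; ∈-map⁻; ∈-++⁺ˡ; ∈-++⁻; ∈-filter⁺; ∈-filter⁻)
open import Data.List.Relation.Unary.Any using (here; there)
open import Data.Maybe.Base as Maybe using (Maybe)
open import Data.Nat.Base using (ℕ; _⊓_)
open import Data.Product.Base using (Σ; ∃; _×_; _,_; uncurry)
open import Data.Sum.Base using (inj₁; inj₂)
open import Function.Base using (_∘_)
open import Function.Bundles using (_↔_; module Inverse)
open import Relation.Binary.Bundles using (DecSetoid)
open import Relation.Binary.Construct.Closure.ReflexiveTransitive using (Star)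
import Relation.Binary.Construct.Interior.Symmetric as SymInt
import Relation.Binary.Construct.On as On
open import Relation.Binary.Core using (Rel)
open import Relation.Binary.Definitions using (Decidable; DecidableEquality)
open import Relation.Binary.PropositionalEquality.Core using (_≡_; refl; sym; trans; cong; subst)
open import Relation.Nullary.Decidable.Core using (no; dec⇒maybe; map′; ¬?)
open import Relation.Nullary.Negation.Core using (¬_)
import Data.List.Membership.DecPropositional as DecMembership
import Data.List.Membership.DecSetoid as DecSetoidMembership
import Data.List.Relation.Binary.Subset.DecPropositional as DecSubset
import Data.List.Relation.Binary.Subset.Setoid as SetoidSubset

data Literal (V : Set) : Set where
  pos neg : V → Literal V

module _ {V : Set} where

  var : Literal V → V
  var (pos v) = v
  var (neg v) = v

  comp : Literal V → Literal V
  comp (pos v) = neg v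
  comp (neg v) = pos v

  comp-involutive : ∀ x → comp (comp x) ≡ x
  comp-involutive (pos v) = refl
  comp-involutive (neg v) = refl

  var-comp : ∀ x → var (comp x) ≡ var x
  var-comp (pos v) = refl
  var-comp (neg v) = refl

  comp≢ : ∀ x → ¬ comp x ≡ x
  comp≢ (pos v) ()
  comp≢ (neg v) ()

module ClauseSets {V : Set} (_≟_ : DecidableEquality V) where

  Lit : Set
  Lit = Literal V

  _≟ᴸ_ : DecidableEquality Lit
  pos v ≟ᴸ pos w = map′ (cong pos) (cong var) (v ≟ w)
  pos v ≟ᴸ neg w = no λ ()
  neg v ≟ᴸ pos w = no λ ()
  neg v ≟ᴸ neg w = map′ (cong neg) (cong var) (v ≟ w)

  open DecMembership _≟_ using () renaming (_∈_ to _∈ⱽ_; _∉_ to _∉ⱽ_; _∉?_ to _∉ⱽ?_)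
  open DecMembership _≟ᴸ_ using () renaming (_∈_ to _∈ᴸ_; _∉_ to _∉ᴸ_; _∈?_ to _∈ᴸ?_; _∉?_ to _∉ᴸ?_)
  open DecSubset _≟ᴸ_ using () renaming (_⊆_ to _⊆ᴸ_; _⊆?_ to _⊆ᴸ?_)

  -- Finite sets are lists taken up to mutual inclusion, so neither order nor
  -- multiplicity of the entries is significant.

  infix 4 _≈ᴸ_ _≈ᴸ?_
  infixl 7 _∩_
  infixl 6 _∖_

  _≈ᴸ_ : Rel (List Lit) _
  _≈ᴸ_ = SymInt.SymInterior _⊆ᴸ_

  _≈ᴸ?_ : Decidable _≈ᴸ_
  _≈ᴸ?_ = SymInt.decidable _⊆ᴸ?_

  _∩_ : List Lit → List Lit → List Lit
  xs ∩ ys = filter (_∈ᴸ? ys) xs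

  _∖_ : List Lit → List Lit → List Lit
  xs ∖ ys = filter (_∉ᴸ? ys) xs

  NoClash : List Lit → Set
  NoClash xs = ∀ {x} → x ∈ᴸ xs → comp x ∉ᴸ xs

  record Clause : Set where
    constructor clause
    field
      lits    : List Lit
      noClash : NoClash lits

  open Clause public

  clauseDecSetoid : DecSetoid _ _
  clauseDecSetoid = record
    { isDecEquivalence = On.isDecEquivalence lits
        (SymInt.isDecEquivalence {R = _⊆ᴸ_} (λ p → p) (λ p q → q ∘ p) _⊆ᴸ?_) }

  open DecSetoid clauseDecSetoid public
    using () renaming (_≈_ to _≈ᶜ_; _≟_ to _≈ᶜ?_; setoid to clauseSetoid)

  ClauseSet : Set
  ClauseSet = List Clause

  open DecSetoidMembership clauseDecSetoid public using (_∈_)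
  open SetoidSubset clauseSetoid public using (_⊆_)

  infix 4 _≈_

  _≈_ : Rel ClauseSet _
  _≈_ = SymInt.SymInterior _⊆_

  varsᶜ : Clause → List V
  varsᶜ C = map var (lits C)

  vars : ClauseSet → List V
  vars = concatMap varsᶜ

  remove : Clause → ClauseSet → ClauseSet
  remove C = filter (λ D → ¬? (D ≈ᶜ? C))

  -- Distinct list entries may denote the same clause, hence the deduplication.
  ldeg : ClauseSet → Lit → ℕ
  ldeg F x = length (deduplicate _≈ᶜ?_ (filter (λ C → x ∈ᴸ? lits C) F))

  Assignment : Set
  Assignment = V → Bool

  value : Assignment → Lit → Bool
  value φ (pos v) = φ v
  value φ (neg v) = not (φ v)

  Satisfies : Assignment → ClauseSet → Set
  Satisfies φ F = ∀ {C} → C ∈ F → ∃ λ x → x ∈ᴸ lits C × value φ x ≡ true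

  Satisfiable : ClauseSet → Set
  Satisfiable F = ∃ λ φ → Satisfies φ F

  MU : ClauseSet → Set
  MU F = ¬ Satisfiable F × (∀ {C} → C ∈ F → Satisfiable (remove C F))

  module _ (v : V) (C D : Clause) where

    Resolvable : Set
    Resolvable = lits C ∩ map comp (lits D) ≈ᴸ [ pos v ]

    resolventLits : List Lit
    resolventLits = (lits C ++ lits D) ∖ (pos v ∷ neg v ∷ [])

    resolvent-noClash : Resolvable → NoClash resolventLits
    resolvent-noClash r {x} x∈ x̄∈
      with ∈-filter⁻ (_∉ᴸ? _) {xs = lits C ++ lits D} x∈
         | ∈-filter⁻ (_∉ᴸ? _) {xs = lits C ++ lits D} x̄∈
    ... | x∈CD , x≢ | x̄∈CD , x̄≢ with ∈-++⁻ (lits C) x∈CD | ∈-++⁻ (lits C) x̄∈CD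
    ... | inj₁ x∈C | inj₁ x̄∈C = noClash C x∈C x̄∈C
    ... | inj₂ x∈D | inj₂ x̄∈D = noClash D x∈D x̄∈D
    ... | inj₁ x∈C | inj₂ x̄∈D = x≢ (∈-++⁺ˡ (SymInt.lhs≤rhs r
          (∈-filter⁺ (_∈ᴸ? _) x∈C
            (subst (_∈ᴸ map comp (lits D)) (comp-involutive x) (∈-map⁺ comp x̄∈D)))))
    ... | inj₂ x∈D | inj₁ x̄∈C = x̄≢ (∈-++⁺ˡ (SymInt.lhs≤rhs r
          (∈-filter⁺ (_∈ᴸ? _) x̄∈C (∈-map⁺ comp x∈D))))

    resolvent : Resolvable → Clause
    resolvent r = clause resolventLits (resolvent-noClash r)

    resolve : Maybe Clause
    resolve = Maybe.map resolvent
      (dec⇒maybe (lits C ∩ map comp (lits D) ≈ᴸ? [ pos v ]))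

  DP : V → ClauseSet → ClauseSet
  DP v F = filter (λ C → v ∉ⱽ? varsᶜ C) F
        ++ mapMaybe (uncurry (resolve v)) (cartesianProduct F F)

  adjoin-noClash : ∀ C x → var x ∉ⱽ varsᶜ C → NoClash (x ∷ lits C)
  adjoin-noClash C x x∉ (here refl)  (here eq)   = comp≢ x eq
  adjoin-noClash C x x∉ (here refl)  (there x̄∈) =
    x∉ (subst (_∈ⱽ varsᶜ C) (var-comp x) (∈-map⁺ var x̄∈))
  adjoin-noClash C x x∉ {y} (there y∈) (here eq) =
    x∉ (subst (_∈ⱽ varsᶜ C) (trans (sym (var-comp y)) (cong var eq)) (∈-map⁺ var y∈))
  adjoin-noClash C x x∉ (there y∈)   (there ȳ∈) = noClash C y∈ ȳ∈

  adjoin : ∀ C x → var x ∉ⱽ varsᶜ C → Clause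
  adjoin C x x∉ = clause (x ∷ lits C) (adjoin-noClash C x x∉)

  Saturated : ClauseSet → Set
  Saturated F = ∀ {C} → C ∈ F → ∀ x → var x ∈ⱽ vars F → (x∉ : var x ∉ⱽ varsᶜ C) →
    Satisfiable (adjoin C x x∉ ∷ remove C F)

  Singular : ClauseSet → V → Set
  Singular F v = ldeg F (pos v) ⊓ ldeg F (neg v) ≡ 1

  Nonsingular : ClauseSet → Set
  Nonsingular F = ∀ v → ¬ Singular F v

  infix 4 _⇝_ _∈sDP_

  data _⇝_ (F : ClauseSet) : ClauseSet → Set where
    step : ∀ {v} → MU F → Singular F v → F ⇝ DP v F

  -- DP v F stands for its whole ≈-class: every notion here respects ≈.
  _∈sDP_ : ClauseSet → ClauseSet → Set
  F′ ∈sDP F = MU F′ × Nonsingular F′ × Star _⇝_ F F′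

  EventuallySaturated : ClauseSet → Set
  EventuallySaturated F = ∀ {F′} → F′ ∈sDP F → Saturated F′

  record Renaming : Set where
    field
      bijection : Lit ↔ Lit

    open Inverse bijection public using (to; from; strictlyInverseʳ)

    field
      to-comp : ∀ x → to (comp x) ≡ comp (to x)

    to-injective : ∀ {x y} → to x ≡ to y → x ≡ y
    to-injective {x} {y} eq =
      trans (sym (strictlyInverseʳ x)) (trans (cong from eq) (strictlyInverseʳ y))

    rename-noClash : ∀ C → NoClash (map to (lits C))
    rename-noClash C y∈ ȳ∈ with ∈-map⁻ to y∈ | ∈-map⁻ to ȳ∈
    ... | x , x∈C , refl | x′ , x′∈C , eq =
      noClash C x∈C (subst (_∈ᴸ lits C) (to-injective (trans (sym eq) (sym (to-comp x)))) x′∈C)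

    rename : Clause → Clause
    rename C = clause (map to (lits C)) (rename-noClash C)

  Isomorphic : ClauseSet → ClauseSet → Set
  Isomorphic F G = Σ Renaming λ ρ → map (Renaming.rename ρ) F ≈ G

module Submission where

-- A literal x of a minimally unsatisfiable F that occurs once, in its main
-- clause C, clashes with no clause containing its complement except on x, and
-- G ↦ (resolvent of C and G on x, or G itself) is injective on F ∖ {C}. Hence
-- the reductions at two singular literals x, y preserve each other's
-- singularity, and then commute, unless x and y share the main clause and both
-- complements occur at least twice. In that exceptional case, either some third
-- singular literal is not so related to x and y, and its reduction commutes with
-- both, or DP_x(F) and DP_y(F) are already nonsingular, hence saturated;
-- saturation forces C ∖ {x, y} into every clause containing comp x or comp y, so
-- exchanging x with comp y is an isomorphism. Induction on the number of
-- variables concludes.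

open import Data.Bool.Base using (Bool; true; false; not; if_then_else_)
open import Data.Bool.Properties using (¬-not)
open import Data.Empty using (⊥-elim)
open import Data.List.Base
  using (List; []; _∷_; _++_; [_]; map; concatMap; filter; mapMaybe; deduplicate; cartesianProduct; length)
open import Data.List.Membership.Propositional using (find; lose)
open import Data.List.Membership.Propositional.Properties
  using (∈-map⁺; ∈-map⁻; ∈-++⁺ˡ; ∈-++⁺ʳ; ∈-++⁻; ∈-filter⁺; ∈-filter⁻
        ; ∈-cartesianProduct⁺; ∈-cartesianProduct⁻)
import Data.List.Membership.DecPropositional as DecMembership
import Data.List.Membership.Setoid.Properties as SetoidMembershipₚ
open import Data.List.Properties using (filter-notAll)
open import Data.List.Relation.Unary.All as All using ([]; _∷_)
open import Data.List.Relation.Unary.AllPairs using ([]; _∷_)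
open import Data.List.Relation.Unary.Any as Any using (Any; here; there)
import Data.List.Relation.Unary.Any.Properties as Anyₚ
import Data.List.Relation.Unary.Unique.Setoid as SetoidUnique
open import Data.List.Relation.Unary.Unique.DecSetoid.Properties using (deduplicate-!)
open import Data.Maybe.Base using (Maybe; just; nothing)
open import Data.Maybe.Relation.Unary.Any as MAny using (just)
open import Data.Nat.Base using (ℕ; zero; suc; _≤_; _<_; _⊓_; s≤s)
import Data.Nat.Properties as ℕₚ
open import Data.Product.Base using (∃; ∃₂; _×_; _,_; proj₁; proj₂; uncurry)
open import Data.Sum.Base using (_⊎_; inj₁; inj₂; [_,_]′)
import Data.Sum.Base as Sum
open import Function.Base using (_∘_; id; case_of_)
open import Function.Bundles using (mk↔ₛ′)
open import Function.Construct.Composition using (_↔-∘_)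
open import Relation.Binary.Bundles using (DecSetoid)
open import Relation.Binary.Construct.Closure.ReflexiveTransitive using (Star; ε; _◅_)
open import Relation.Binary.Construct.Interior.Symmetric using (_,_; lhs≤rhs; rhs≤lhs)
open import Relation.Binary.Definitions using (DecidableEquality)
open import Relation.Binary.PropositionalEquality
  using (_≡_; _≢_; refl; sym; trans; cong; subst)
open import Relation.Nullary using (¬_; Dec; yes; no; contradiction)
open import Relation.Nullary.Decidable using (does; toSum; dec-true; dec-false; decidable-stable; ¬?; _×-dec_; map′)
open import Defs

-- Literals, lists and minima

private
  true≢false : {b : Bool} → b ≡ true → ¬ b ≡ false
  true≢false refl ()

module _ {V : Set} where

  comp-injective : {x y : Literal V} → comp x ≡ comp y → x ≡ y
  comp-injective {x} {y} e =
    trans (sym (comp-involutive x)) (trans (cong comp e) (comp-involutive y))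

  ≡-comp : {x y : Literal V} → comp x ≡ y → x ≡ comp y
  ≡-comp {x} e = trans (sym (comp-involutive x)) (cong comp e)

  var-≡ : (x y : Literal V) → var x ≡ var y → x ≡ y ⊎ x ≡ comp y
  var-≡ (pos _) (pos _) refl = inj₁ refl
  var-≡ (pos _) (neg _) refl = inj₂ refl
  var-≡ (neg _) (pos _) refl = inj₂ refl
  var-≡ (neg _) (neg _) refl = inj₁ refl

mapMaybe⁻ : {A B : Set} {P : B → Set} (f : A → Maybe B) (xs : List A) →
  Any P (mapMaybe f xs) → Any (MAny.Any P ∘ f) xs
mapMaybe⁻ f (x ∷ xs) p with f x in eq | p
... | nothing | q       = there (mapMaybe⁻ f xs q)
... | just _  | here q  = here (subst (MAny.Any _) (sym eq) (just q))
... | just _  | there q = there (mapMaybe⁻ f xs q)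

⊓≡1⁻ : ∀ m n → m ⊓ n ≡ 1 → (m ≡ 1 × 1 ≤ n) ⊎ (n ≡ 1 × 1 ≤ m)
⊓≡1⁻ m n e with ℕₚ.⊓-sel m n
... | inj₁ p = inj₁ (trans (sym p) e , subst (_≤ n) e (ℕₚ.m⊓n≤n m n))
... | inj₂ p = inj₂ (trans (sym p) e , subst (_≤ m) e (ℕₚ.m⊓n≤m m n))

module _ {V : Set} (_≟_ : DecidableEquality V) where

  open ClauseSets _≟_
  open DecMembership _≟_ using () renaming (_∈_ to _∈ⱽ_; _∉_ to _∉ⱽ_; _∉?_ to _∉ⱽ?_)
  open DecMembership _≟ᴸ_ using () renaming (_∈_ to _∈ᴸ_; _∉_ to _∉ᴸ_; _∈?_ to _∈ᴸ?_; _∉?_ to _∉ᴸ?_)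
  open SetoidMembershipₚ using (∈-resp-≈)
  private module ≈ᶜ = DecSetoid clauseDecSetoid

  private variable
    x y z : Lit
    v w : V

  -- The clash-freeness proofs stored in clauses are not determined by the types
  -- C ≈ᶜ D and C ∈ F, so clauses are passed explicitly throughout.

  ∉⇒≢ : {xs : List Lit} → x ∉ᴸ xs → z ∈ᴸ xs → z ≢ x
  ∉⇒≢ x∉ z∈ refl = x∉ z∈

  ∈-resp : ∀ C D F → C ≈ᶜ D → C ∈ F → D ∈ F
  ∈-resp C D F = ∈-resp-≈ clauseSetoid {F} {C} {D}

  ≡⇒∈ : ∀ C F → Any (C ≡_) F → C ∈ F
  ≡⇒∈ C F = Any.map λ { refl → ≈ᶜ.refl {C} }

  ∈-find : ∀ C F → C ∈ F → ∃ λ D → Any (D ≡_) F × C ≈ᶜ D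
  ∈-find C F = find

  ∈-remove⁺ : ∀ C D F → D ∈ F → ¬ D ≈ᶜ C → D ∈ remove C F
  ∈-remove⁺ C D F = SetoidMembershipₚ.∈-filter⁺ clauseSetoid _
    (λ {A} {B} A≈B A≉C B≈C → A≉C (≈ᶜ.trans {A} {B} {C} A≈B B≈C)) {D} {F}

  ∈-remove⁻ : ∀ C D F → D ∈ remove C F → D ∈ F × ¬ D ≈ᶜ C
  ∈-remove⁻ C D F = SetoidMembershipₚ.∈-filter⁻ clauseSetoid _
    (λ {A} {B} A≈B A≉C B≈C → A≉C (≈ᶜ.trans {A} {B} {C} A≈B B≈C)) {D} {F}

  ∈-literals : ∀ C F → C ∈ F → x ∈ᴸ lits C → x ∈ᴸ concatMap lits F
  ∈-literals C (D ∷ F) (here C≈D) x∈C = ∈-++⁺ˡ (lhs≤rhs C≈D x∈C)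
  ∈-literals C (D ∷ F) (there C∈F) x∈C = ∈-++⁺ʳ (lits D) (∈-literals C F C∈F x∈C)

  ∈-vars⁺ : ∀ C F → C ∈ F → x ∈ᴸ lits C → var x ∈ⱽ vars F
  ∈-vars⁺ C (D ∷ F) (here C≈D) x∈C = ∈-++⁺ˡ (∈-map⁺ var (lhs≤rhs C≈D x∈C))
  ∈-vars⁺ C (D ∷ F) (there C∈F) x∈C = ∈-++⁺ʳ (varsᶜ D) (∈-vars⁺ C F C∈F x∈C)

  ∈-vars⁻ : ∀ F → v ∈ⱽ vars F → ∃₂ λ x C → v ≡ var x × C ∈ F × x ∈ᴸ lits C
  ∈-vars⁻ (D ∷ F) v∈ with ∈-++⁻ (varsᶜ D) v∈
  ... | inj₁ v∈D = let x , x∈D , e = ∈-map⁻ var v∈D in x , D , e , here (≈ᶜ.refl {D}) , x∈D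
  ... | inj₂ v∈F = let x , C , e , C∈F , x∈C = ∈-vars⁻ F v∈F in x , C , e , there C∈F , x∈C

  ∉-varsᶜ : ∀ C x → x ∉ᴸ lits C → comp x ∉ᴸ lits C → var x ∉ⱽ varsᶜ C
  ∉-varsᶜ C x x∉ x̄∉ v∈ with ∈-map⁻ var v∈
  ... | y , y∈C , e with var-≡ y x (sym e)
  ...   | inj₁ refl = x∉ y∈C
  ...   | inj₂ refl = x̄∉ y∈C

  -- Resolvents

  -- Resolution on an arbitrary literal, described by membership alone. `DP` resolves on `pos v`
  -- only; this form lets `resolvent-comp` exchange the parents, so that `x` can later be whichever
  -- literal of its variable occurs once.
  record Resolvent (x : Lit) (P Q E : Clause) : Set where
    field
      x∈P  : x ∈ᴸ lits P
      x̄∈Q  : comp x ∈ᴸ lits Q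
      only : ∀ {z} → z ∈ᴸ lits P → comp z ∈ᴸ lits Q → z ≡ x
      ∈⁻   : ∀ {z} → z ∈ᴸ lits E → (z ∈ᴸ lits P ⊎ z ∈ᴸ lits Q) × z ≢ x × z ≢ comp x
      ∈⁺ˡ  : ∀ {z} → z ∈ᴸ lits P → z ≢ x → z ∈ᴸ lits E
      ∈⁺ʳ  : ∀ {z} → z ∈ᴸ lits Q → z ≢ comp x → z ∈ᴸ lits E

    x∉ : x ∉ᴸ lits E
    x∉ x∈E = proj₁ (proj₂ (∈⁻ x∈E)) refl

    x̄∉ : comp x ∉ᴸ lits E
    x̄∉ x∈E = proj₂ (proj₂ (∈⁻ x∈E)) refl

  open Resolvent

  resolvent-comp : ∀ {x} P Q E → Resolvent x P Q E → Resolvent (comp x) Q P E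
  resolvent-comp {x} P Q E r = record
    { x∈P  = x̄∈Q r
    ; x̄∈Q  = subst (_∈ᴸ lits P) (sym (comp-involutive x)) (x∈P r)
    ; only = λ {z} z∈Q z̄∈P → ≡-comp (only r z̄∈P (subst (_∈ᴸ lits Q) (sym (comp-involutive z)) z∈Q))
    ; ∈⁻   = λ z∈ → let s , z≢x , z≢x̄ = ∈⁻ r z∈ in
        Sum.swap s , z≢x̄ , λ e → z≢x (trans e (comp-involutive x))
    ; ∈⁺ˡ  = ∈⁺ʳ r
    ; ∈⁺ʳ  = λ z∈ z≢ → ∈⁺ˡ r z∈ λ e → z≢ (trans e (sym (comp-involutive x)))
    }

  resolvent-cong : ∀ {x} P Q P′ Q′ E E′ → P ≈ᶜ P′ → Q ≈ᶜ Q′ → E ≈ᶜ E′ →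
    Resolvent x P Q E → Resolvent x P′ Q′ E′
  resolvent-cong P Q P′ Q′ E E′ p q e r = record
    { x∈P  = lhs≤rhs p (x∈P r)
    ; x̄∈Q  = lhs≤rhs q (x̄∈Q r)
    ; only = λ z∈ z̄∈ → only r (rhs≤lhs p z∈) (rhs≤lhs q z̄∈)
    ; ∈⁻   = λ z∈ → let s , n = ∈⁻ r (rhs≤lhs e z∈) in Sum.map (lhs≤rhs p) (lhs≤rhs q) s , n
    ; ∈⁺ˡ  = λ z∈ n → lhs≤rhs e (∈⁺ˡ r (rhs≤lhs p z∈) n)
    ; ∈⁺ʳ  = λ z∈ n → lhs≤rhs e (∈⁺ʳ r (rhs≤lhs q z∈) n)
    }

  resolvent-⊆ : ∀ {x} P Q E E′ → Resolvent x P Q E → Resolvent x P Q E′ → z ∈ᴸ lits E → z ∈ᴸ lits E′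
  resolvent-⊆ P Q E E′ r r′ z∈ with ∈⁻ r z∈
  ... | inj₁ z∈P , n , _ = ∈⁺ˡ r′ z∈P n
  ... | inj₂ z∈Q , _ , n = ∈⁺ʳ r′ z∈Q n

  resolvent-unique : ∀ {x} P Q E E′ → Resolvent x P Q E → Resolvent x P Q E′ → E ≈ᶜ E′
  resolvent-unique P Q E E′ r r′ = resolvent-⊆ P Q E E′ r r′ , resolvent-⊆ P Q E′ E r′ r

  resolvent-resolvent : ∀ v P Q r → Resolvent (pos v) P Q (resolvent v P Q r)
  resolvent-resolvent v P Q r = record
    { x∈P  = proj₁ v∈
    ; x̄∈Q  = v̄∈
    ; only = λ {z} z∈ z̄∈ → case lhs≤rhs r
        (∈-filter⁺ (_∈ᴸ? _) z∈ (subst (_∈ᴸ map comp (lits Q)) (comp-involutive z) (∈-map⁺ comp z̄∈)))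
        of λ { (here e) → e }
    ; ∈⁻   = λ z∈ → let z∈PQ , z∉ = ∈-filter⁻ (_∉ᴸ? _) {xs = lits P ++ lits Q} z∈ in
        ∈-++⁻ (lits P) z∈PQ , (λ e → z∉ (here e)) , (λ e → z∉ (there (here e)))
    ; ∈⁺ˡ  = λ z∈ n → ∈-filter⁺ (_∉ᴸ? _) (∈-++⁺ˡ z∈)
        λ { (here e) → n e ; (there (here refl)) → noClash P z∈ (proj₁ v∈) }
    ; ∈⁺ʳ  = λ z∈ n → ∈-filter⁺ (_∉ᴸ? _) (∈-++⁺ʳ (lits P) z∈)
        λ { (here refl) → noClash Q z∈ v̄∈ ; (there (here e)) → n e }
    }
    where
    v∈ : pos v ∈ᴸ lits P × pos v ∈ᴸ map comp (lits Q)
    v∈ = ∈-filter⁻ (_∈ᴸ? map comp (lits Q)) {xs = lits P} (rhs≤lhs r (here refl))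
    v̄∈ : neg v ∈ᴸ lits Q
    v̄∈ with ∈-map⁻ comp (proj₂ v∈)
    ... | neg _ , z∈ , refl = z∈

  resolve⁻ : ∀ v P Q E → MAny.Any (E ≈ᶜ_) (resolve v P Q) → Resolvent (pos v) P Q E
  resolve⁻ v P Q E m with lits P ∩ map comp (lits Q) ≈ᴸ? [ pos v ] | m
  ... | yes r | just e = resolvent-cong P Q P Q R E (≈ᶜ.refl {P}) (≈ᶜ.refl {Q}) (≈ᶜ.sym {E} {R} e)
                           (resolvent-resolvent v P Q r)
    where R = resolvent v P Q r

  resolve⁺ : ∀ v P Q → pos v ∈ᴸ lits P → neg v ∈ᴸ lits Q →
    (∀ {z} → z ∈ᴸ lits P → comp z ∈ᴸ lits Q → z ≡ pos v) →
    ∃ λ E → MAny.Any (E ≈ᶜ_) (resolve v P Q)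
  resolve⁺ v P Q v∈ v̄∈ o with lits P ∩ map comp (lits Q) ≈ᴸ? [ pos v ]
  ... | yes r = resolvent v P Q r , just (≈ᶜ.refl {resolvent v P Q r})
  ... | no ¬r = contradiction
    ( (λ z∈ → let z∈P , z∈Q = ∈-filter⁻ (_∈ᴸ? map comp (lits Q)) {xs = lits P} z∈
                  y , y∈Q , e = ∈-map⁻ comp z∈Q in
          here (o z∈P (subst (_∈ᴸ lits Q) (≡-comp (sym e)) y∈Q)))
    , λ { (here refl) → ∈-filter⁺ (_∈ᴸ? _) v∈ (∈-map⁺ comp v̄∈) } ) ¬r

  -- Clauses of a DP-reduct

  DP⁻-pos : ∀ v F E → E ∈ DP v F → (E ∈ F × v ∉ⱽ varsᶜ E) ⊎
    (∃₂ λ P Q → P ∈ F × Q ∈ F × Resolvent (pos v) P Q E)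
  DP⁻-pos v F E E∈ with Anyₚ.++⁻ (filter (λ C → v ∉ⱽ? varsᶜ C) F) E∈
  ... | inj₁ E∈ᶠ with ∈-find E (filter (λ C → v ∉ⱽ? varsᶜ C) F) E∈ᶠ
  ...   | D , D∈ , E≈D = let D∈F , v∉ = ∈-filter⁻ (λ C → v ∉ⱽ? varsᶜ C) {xs = F} D∈ in
          inj₁ (∈-resp D E F (≈ᶜ.sym {E} {D} E≈D) (≡⇒∈ D F D∈F) , λ v∈ →
            let z , z∈ , e = ∈-map⁻ var v∈ in v∉ (subst (_∈ⱽ varsᶜ D) (sym e) (∈-map⁺ var (lhs≤rhs E≈D z∈))))
  DP⁻-pos v F E E∈ | inj₂ E∈ʳ
    with find (mapMaybe⁻ (uncurry (resolve v)) (cartesianProduct F F) E∈ʳ)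
  ... | (P , Q) , PQ∈ , m = let P∈ , Q∈ = ∈-cartesianProduct⁻ F F PQ∈ in
        inj₂ (P , Q , ≡⇒∈ P F P∈ , ≡⇒∈ Q F Q∈ , resolve⁻ v P Q E m)

  DP⁺ᵏ-pos : ∀ v F E → E ∈ F → v ∉ⱽ varsᶜ E → E ∈ DP v F
  DP⁺ᵏ-pos v F E E∈ v∉ with ∈-find E F E∈
  ... | D , D∈F , E≈D = ∈-resp D E (DP v F) (≈ᶜ.sym {E} {D} E≈D) (Anyₚ.++⁺ˡ
      (≡⇒∈ D (filter (λ C → v ∉ⱽ? varsᶜ C) F) (∈-filter⁺ (λ C → v ∉ⱽ? varsᶜ C) D∈F λ v∈ →
        let z , z∈ , e = ∈-map⁻ var v∈ in v∉ (subst (_∈ⱽ varsᶜ E) (sym e) (∈-map⁺ var (rhs≤lhs E≈D z∈))))))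

  DP⁺ʳ-pos : ∀ v F P Q → P ∈ F → Q ∈ F → pos v ∈ᴸ lits P → neg v ∈ᴸ lits Q →
    (∀ {z} → z ∈ᴸ lits P → comp z ∈ᴸ lits Q → z ≡ pos v) →
    ∃ λ E → E ∈ DP v F × Resolvent (pos v) P Q E
  DP⁺ʳ-pos v F P Q P∈ Q∈ v∈ v̄∈ o with ∈-find P F P∈ | ∈-find Q F Q∈
  ... | P′ , P′∈ , p | Q′ , Q′∈ , q with resolve⁺ v P′ Q′ (lhs≤rhs p v∈) (lhs≤rhs q v̄∈)
                                           (λ z∈ z̄∈ → o (rhs≤lhs p z∈) (rhs≤lhs q z̄∈))
  ...   | E , m = E
        , Anyₚ.++⁺ʳ (filter (λ C → v ∉ⱽ? varsᶜ C) F)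
            (Anyₚ.mapMaybe⁺ _ (cartesianProduct F F)
              (Anyₚ.map⁺ (lose (∈-cartesianProduct⁺ P′∈ Q′∈) m)))
        , resolvent-cong P′ Q′ P Q E E (≈ᶜ.sym {P} {P′} p) (≈ᶜ.sym {Q} {Q′} q) (≈ᶜ.refl {E})
            (resolve⁻ v P′ Q′ E m)

  data DP-View (x : Lit) (F : ClauseSet) (E : Clause) : Set where
    kept     : E ∈ F → x ∉ᴸ lits E → comp x ∉ᴸ lits E → DP-View x F E
    resolved : ∀ P Q → P ∈ F → Q ∈ F → Resolvent x P Q E → DP-View x F E

  DP⁻ : ∀ x F E → E ∈ DP (var x) F → DP-View x F E
  DP⁻ x F E E∈ with DP⁻-pos (var x) F E E∈
  ... | inj₁ (E∈F , v∉) = kept E∈F (λ x∈ → v∉ (∈-map⁺ var x∈))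
          (λ x̄∈ → v∉ (subst (_∈ⱽ varsᶜ E) (var-comp x) (∈-map⁺ var x̄∈)))
  DP⁻ (pos v) F E E∈ | inj₂ (P , Q , P∈ , Q∈ , r) = resolved P Q P∈ Q∈ r
  DP⁻ (neg v) F E E∈ | inj₂ (P , Q , P∈ , Q∈ , r) = resolved Q P Q∈ P∈ (resolvent-comp P Q E r)

  DP⁺ᵏ : ∀ x F E → E ∈ F → x ∉ᴸ lits E → comp x ∉ᴸ lits E → E ∈ DP (var x) F
  DP⁺ᵏ x F E E∈ x∉ x̄∉ = DP⁺ᵏ-pos (var x) F E E∈ (∉-varsᶜ E x x∉ x̄∉)

  DP⁺ʳ : ∀ x F P Q → P ∈ F → Q ∈ F → x ∈ᴸ lits P → comp x ∈ᴸ lits Q →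
    (∀ {z} → z ∈ᴸ lits P → comp z ∈ᴸ lits Q → z ≡ x) →
    ∃ λ E → E ∈ DP (var x) F × Resolvent x P Q E
  DP⁺ʳ (pos v) F P Q P∈ Q∈ v∈ v̄∈ o = DP⁺ʳ-pos v F P Q P∈ Q∈ v∈ v̄∈ o
  DP⁺ʳ (neg v) F P Q P∈ Q∈ v∈ v̄∈ o =
    let E , E∈ , r = DP⁺ʳ-pos v F Q P Q∈ P∈ v̄∈ v∈ λ {z} z∈ z̄∈ →
                       ≡-comp (o z̄∈ (subst (_∈ᴸ lits Q) (sym (comp-involutive z)) z∈))
    in E , E∈ , resolvent-comp Q P E r

  -- A total valuation may make a variable and its complement both true. This
  -- admits the valuation falsifying exactly the literals of a given clause C,
  -- which violates a clause-set if and only if C is subsumed by one of its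
  -- elements, and DP still acts as elimination of a variable.

  Valuation : Set
  Valuation = Lit → Bool

  private variable
    σ τ : Valuation

  Models : Valuation → ClauseSet → Set
  Models σ F = ∀ C → C ∈ F → ∃ λ z → z ∈ᴸ lits C × σ z ≡ true

  Falsifies : Valuation → Clause → Set
  Falsifies σ C = ∀ {z} → z ∈ᴸ lits C → σ z ≡ false

  Total : Valuation → Set
  Total σ = ∀ x → σ x ≡ false → ¬ σ (comp x) ≡ false

  true⇒≢false : σ z ≡ true → σ x ≡ false → z ≢ x
  true⇒≢false e f refl = true≢false e f

  satisfied? : ∀ (σ : Valuation) xs → (∃ λ z → z ∈ᴸ xs × σ z ≡ true) ⊎ (∀ {z} → z ∈ᴸ xs → σ z ≡ false)
  satisfied? σ [] = inj₂ λ ()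
  satisfied? σ (x ∷ xs) with σ x in eq | satisfied? σ xs
  ... | true  | _                  = inj₁ (x , here refl , eq)
  ... | false | inj₁ (z , z∈ , e)  = inj₁ (z , there z∈ , e)
  ... | false | inj₂ f             = inj₂ λ { (here refl) → eq ; (there z∈) → f z∈ }

  models? : ∀ σ F → Models σ F ⊎ ∃ λ C → C ∈ F × Falsifies σ C
  models? σ [] = inj₁ λ _ ()
  models? σ (C ∷ F) with satisfied? σ (lits C) | models? σ F
  ... | inj₂ f            | _                  = inj₂ (C , here (≈ᶜ.refl {C}) , f)
  ... | inj₁ _            | inj₂ (D , D∈ , f)  = inj₂ (D , there D∈ , f)
  ... | inj₁ (z , z∈ , e) | inj₁ m             = inj₁ λ
    { D (here D≈C) → z , rhs≤lhs D≈C z∈ , e ; D (there D∈) → m D D∈ }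

  ¬falsifies : ∀ {σ} C F → Models σ F → C ∈ F → ¬ Falsifies σ C
  ¬falsifies C F m C∈ f = let z , z∈ , e = m C C∈ in true≢false e (f z∈)

  models-cong : ∀ F → (∀ z → σ z ≡ τ z) → Models σ F → Models τ F
  models-cong F e m C C∈ = let z , z∈ , t = m C C∈ in z , z∈ , trans (sym (e z)) t

  value-total : ∀ φ → Total (value φ)
  value-total φ (pos v) e ē = true≢false (cong not e) ē
  value-total φ (neg v) e ē = true≢false (cong not ē) e

  value-consistent : ∀ φ x → value φ x ≡ true → ¬ value φ (comp x) ≡ true
  value-consistent φ (pos v) e ē = true≢false ē (cong not e)
  value-consistent φ (neg v) e ē = true≢false e (cong not ē)

  -- Fixing the value of one variable

  -- `x` and `comp x` receive opposite values even where `σ` makes both true; this is what allows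
  -- elimination of a variable to be analysed for valuations that are not assignments.
  upd : Lit → Valuation → Valuation
  upd x σ z = if does (var z ≟ var x) then does (z ≟ᴸ x) else σ z

  upd-≡ : ∀ x σ → upd x σ x ≡ true
  upd-≡ x σ rewrite dec-true (var x ≟ var x) refl = dec-true (x ≟ᴸ x) refl

  upd-comp : ∀ x σ → upd x σ (comp x) ≡ false
  upd-comp x σ rewrite dec-true (var (comp x) ≟ var x) (var-comp x) = dec-false (comp x ≟ᴸ x) (comp≢ x)

  upd-≢ : ∀ x σ → z ≢ x → z ≢ comp x → upd x σ z ≡ σ z
  upd-≢ {z} x σ z≢x z≢x̄
    rewrite dec-false (var z ≟ var x) (λ e → [ z≢x , z≢x̄ ]′ (var-≡ z x e)) = refl

  upd-true⁺ : ∀ x σ → σ z ≡ true → z ≢ comp x → upd x σ z ≡ true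
  upd-true⁺ {z} x σ e z≢x̄ = case toSum (z ≟ᴸ x) of λ
    { (inj₁ refl) → upd-≡ x σ
    ; (inj₂ z≢x)  → trans (upd-≢ x σ z≢x z≢x̄) e }

  upd-true⁻ : ∀ x σ → upd x σ z ≡ true → z ≢ comp x × (z ≢ x → σ z ≡ true)
  upd-true⁻ {z} x σ e = z≢x̄ , λ z≢x → trans (sym (upd-≢ x σ z≢x z≢x̄)) e
    where
    z≢x̄ : z ≢ comp x
    z≢x̄ refl = true≢false e (upd-comp x σ)

  upd-false⁻ : ∀ x σ → upd x σ z ≡ false → z ≢ x × (z ≢ comp x → σ z ≡ false)
  upd-false⁻ {z} x σ e = z≢x , λ z≢x̄ → trans (sym (upd-≢ x σ z≢x z≢x̄)) e
    where
    z≢x : z ≢ x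
    z≢x refl = true≢false (upd-≡ x σ) e

  upd-total : ∀ x → Total σ → Total (upd x σ)
  upd-total {σ} x t z e ē with upd-false⁻ x σ e | upd-false⁻ x σ ē
  ... | z≢x , f | z̄≢x , f̄ = t z (f λ { refl → z̄≢x (comp-involutive x) }) (f̄ (z≢x ∘ comp-injective))

  upd-comm : ∀ x y → var x ≢ var y → ∀ z → upd x (upd y σ) z ≡ upd y (upd x σ) z
  upd-comm x y x≢y z with var z ≟ var x | var z ≟ var y
  ... | yes e | yes e′ = contradiction (trans (sym e) e′) x≢y
  ... | yes _ | no _   = refl
  ... | no _  | yes _  = refl
  ... | no _  | no _   = refl

  assign : Lit → Assignment → Assignment
  assign x φ w = upd x (value φ) (pos w)

  value-assign : ∀ x φ z → value (assign x φ) z ≡ upd x (value φ) z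
  value-assign x φ (pos w) = refl
  value-assign (pos v) φ (neg w) with w ≟ v
  ... | yes _ = refl
  ... | no _  = refl
  value-assign (neg v) φ (neg w) with w ≟ v
  ... | yes _ = refl
  ... | no _  = refl

  unsat-upd : ∀ x φ F → ¬ Satisfiable F → ¬ Models (upd x (value φ)) F
  unsat-upd x φ F unsat m = unsat (assign x φ , λ {C} →
    models-cong F (λ z → sym (value-assign x φ z)) m C)

  -- Models of a DP-reduct

  -- For a resolvent only the parent `Q` containing `comp x` matters: its true literal is not
  -- `comp x`, which is false, and not `x`, which would clash inside `Q`, so it passes to the
  -- resolvent and is already true under `σ`.
  models-DP⁺ : ∀ x F → var x ≡ v → Models (upd x σ) F → Models σ (DP v F)
  models-DP⁺ {σ = σ} x F refl m E E∈ with DP⁻ x F E E∈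
  ... | kept E∈F x∉ x̄∉ = let z , z∈ , e = m E E∈F in
        z , z∈ , proj₂ (upd-true⁻ x σ e) (∉⇒≢ x∉ z∈)
  ... | resolved P Q P∈ Q∈ r with m Q Q∈
  ...   | z , z∈ , e = let z≢x̄ , t = upd-true⁻ x σ e in
          z , ∈⁺ʳ r z∈ z≢x̄ , t λ { refl → noClash Q z∈ (x̄∈Q r) }

  -- If both values of `v` fail, they leave falsified clauses `Q` and `P`. A clause among them
  -- without `v` is kept by `DP` and falsified by `σ`. Otherwise totality of `σ` excludes any clash
  -- of `P` and `Q` besides `v`, so they have a resolvent, and `σ` falsifies it.
  models-DP⁻ : ∀ v F → Total σ → Models σ (DP v F) → ∃ λ x → var x ≡ v × Models (upd x σ) F
  models-DP⁻ {σ} v F total m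
    with models? (upd (pos v) σ) F | models? (upd (neg v) σ) F
  ... | inj₁ m′ | _ = pos v , refl , m′
  ... | inj₂ _  | inj₁ m′ = neg v , refl , m′
  ... | inj₂ (Q , Q∈ , f) | inj₂ (P , P∈ , g)
    with pos v ∈ᴸ? lits P | neg v ∈ᴸ? lits Q
  ...   | no v∉P | _ = ⊥-elim (¬falsifies P (DP v F) m
          (DP⁺ᵏ (pos v) F P P∈ v∉P λ v̄∈ → proj₁ (upd-false⁻ (neg v) σ (g v̄∈)) refl)
          λ z∈ → proj₂ (upd-false⁻ (neg v) σ (g z∈)) (∉⇒≢ v∉P z∈))
  ...   | yes _ | no v̄∉Q = ⊥-elim (¬falsifies Q (DP v F) m
          (DP⁺ᵏ (pos v) F Q Q∈ (λ v∈ → proj₁ (upd-false⁻ (pos v) σ (f v∈)) refl) v̄∉Q)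
          λ z∈ → proj₂ (upd-false⁻ (pos v) σ (f z∈)) (∉⇒≢ v̄∉Q z∈))
  ...   | yes v∈P | yes v̄∈Q =
          let E , E∈ , r = DP⁺ʳ (pos v) F P Q P∈ Q∈ v∈P v̄∈Q λ {z} z∈ z̄∈ →
                decidable-stable (z ≟ᴸ pos v) λ z≢v → total z
                  (proj₂ (upd-false⁻ (neg v) σ (g z∈)) z≢v)
                  (proj₂ (upd-false⁻ (pos v) σ (f z̄∈)) (z≢v ∘ comp-injective))
          in ⊥-elim (¬falsifies E (DP v F) m E∈ λ z∈ → case ∈⁻ r z∈ of λ
            { (inj₁ z∈P , z≢v , _) → proj₂ (upd-false⁻ (neg v) σ (g z∈P)) z≢v
            ; (inj₂ z∈Q , _ , z≢v̄) → proj₂ (upd-false⁻ (pos v) σ (f z∈Q)) z≢v̄ })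

  -- Either order of elimination means that some choice of values for `v` and `w` gives a model of
  -- `F`, and updates at different variables commute.
  models-DP-comm : ∀ v w F → v ≢ w → Total σ → Models σ (DP v (DP w F)) → Models σ (DP w (DP v F))
  models-DP-comm v w F v≢w total m with models-DP⁻ v (DP w F) total m
  ... | x , refl , m₁ with models-DP⁻ w F (upd-total x total) m₁
  ...   | y , refl , m₂ = models-DP⁺ y (DP (var x) F) refl (models-DP⁺ x F refl
            (models-cong F (upd-comm y x (v≢w ∘ sym)) m₂))

  -- Witnesses and subsumption in minimally unsatisfiable clause-sets

  unsat-models : ∀ φ F → ¬ Satisfiable F → ¬ Models (value φ) F
  unsat-models φ F unsat m = unsat (φ , λ {C} → m C)

  -- An assignment that satisfies everything but `C` must falsify `C`, or else it would satisfy `F`.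
  witness : ∀ C F → MU F → C ∈ F →
    ∃ λ φ → (∀ D → D ∈ F → ¬ D ≈ᶜ C → ∃ λ z → z ∈ᴸ lits D × value φ z ≡ true) × Falsifies (value φ) C
  witness C F (unsat , crit) C∈ with crit {C} C∈
  ... | φ , s with satisfied? (value φ) (lits C)
  ...   | inj₂ f = φ , (λ D D∈ D≉C → s {D} (∈-remove⁺ C D F D∈ D≉C)) , f
  ...   | inj₁ (z , z∈ , e) = ⊥-elim (unsat-models φ F unsat λ D D∈ → case D ≈ᶜ? C of λ
            { (yes D≈C) → z , rhs≤lhs D≈C z∈ , e
            ; (no D≉C)  → s {D} (∈-remove⁺ C D F D∈ D≉C) })

  -- A witness for `D` falsifies `D` and hence its subset `C`, although it satisfies every clause
  -- other than `D`.
  subsumption-free : ∀ F → MU F → ∀ C D → C ∈ F → D ∈ F →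
    (∀ {z} → z ∈ᴸ lits C → z ∈ᴸ lits D) → C ≈ᶜ D
  subsumption-free F mu C D C∈ D∈ C⊆D with C ≈ᶜ? D
  ... | yes C≈D = C≈D
  ... | no C≉D = let φ , m , f = witness D F mu D∈
                     z , z∈ , e = m C C∈ C≉D in
    contradiction (f (C⊆D z∈)) (true≢false e)

  refuting : Clause → Valuation
  refuting C z = not (does (z ∈ᴸ? lits C))

  refuting-false⁺ : ∀ C → Falsifies (refuting C) C
  refuting-false⁺ C {z} z∈ = cong not (dec-true (z ∈ᴸ? lits C) z∈)

  refuting-false⁻ : ∀ C → refuting C z ≡ false → z ∈ᴸ lits C
  refuting-false⁻ {z} C e with z ∈ᴸ? lits C
  ... | yes z∈ = z∈

  refuting-total : ∀ C → Total (refuting C)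
  refuting-total C x e ē = noClash C (refuting-false⁻ C e) (refuting-false⁻ C ē)

  -- `refuting C` is no model of `F`, so it falsifies some clause of `G`; it falsifies only literals
  -- of `C`.
  subsumed : ∀ F G → (∀ {σ} → Total σ → Models σ G → Models σ F) → ∀ C → C ∈ F →
    ∃ λ D → D ∈ G × (∀ {z} → z ∈ᴸ lits D → z ∈ᴸ lits C)
  subsumed F G G⊨F C C∈ with models? (refuting C) G
  ... | inj₁ m = ⊥-elim (¬falsifies C F (G⊨F (refuting-total C) m) C∈ (refuting-false⁺ C))
  ... | inj₂ (D , D∈ , f) = D , D∈ , λ z∈ → refuting-false⁻ C (f z∈)

  -- Subsumption from `F` to `G` and back yields clauses B ⊆ D ⊆ C with `B` and `C` in `F`. These
  -- coincide by `subsumption-free`, and `D` is caught between them.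
  equivalent⇒⊆ : ∀ F G → MU F → (∀ {σ} → Total σ → Models σ G → Models σ F) →
    (∀ {σ} → Total σ → Models σ F → Models σ G) → F ⊆ G
  equivalent⇒⊆ F G mu G⊨F F⊨G {C} C∈ with subsumed F G G⊨F C C∈
  ... | D , D∈ , D⊆C with subsumed G F F⊨G D D∈
  ...   | B , B∈ , B⊆D with subsumption-free F mu B C B∈ C∈ (D⊆C ∘ B⊆D)
  ...     | B≈C = ∈-resp D C G (D⊆C , B⊆D ∘ rhs≤lhs B≈C) D∈

  -- Logical equivalence over total valuations determines a minimally unsatisfiable clause-set, so
  -- iterated resolvents need not be compared.
  DP-comm : ∀ v w F → v ≢ w → MU (DP v (DP w F)) → MU (DP w (DP v F)) →
    DP v (DP w F) ≈ DP w (DP v F)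
  DP-comm v w F v≢w mu mu′ =
      (λ {C} → equivalent⇒⊆ _ _ mu (models-DP-comm w v F (v≢w ∘ sym)) (models-DP-comm v w F v≢w) {C})
    , (λ {C} → equivalent⇒⊆ _ _ mu′ (models-DP-comm v w F v≢w) (models-DP-comm w v F (v≢w ∘ sym)) {C})

  -- Literal degrees

  record Once (F : ClauseSet) (x : Lit) (C : Clause) : Set where
    field
      main∈     : C ∈ F
      x∈main    : x ∈ᴸ lits C
      only-main : ∀ D → D ∈ F → x ∈ᴸ lits D → D ≈ᶜ C

  open Once

  -- `Single` also admits a pure literal; the condition on `comp x` in `SingularLit` excludes it,
  -- since there the minimum of the two degrees is 0.
  Single Occurs SingularLit : ClauseSet → Lit → Set
  Single F x = ∃ (Once F x)
  Occurs F x = ∃ λ C → C ∈ F × x ∈ᴸ lits C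
  SingularLit F x = Single F x × Occurs F (comp x)

  occurrences : ClauseSet → Lit → List Clause
  occurrences F x = deduplicate _≈ᶜ?_ (filter (λ C → x ∈ᴸ? lits C) F)

  ∈-occurrences⁺ : ∀ C F x → C ∈ F → x ∈ᴸ lits C → C ∈ occurrences F x
  ∈-occurrences⁺ C F x C∈ x∈ = SetoidMembershipₚ.∈-deduplicate⁺ clauseSetoid _≈ᶜ?_
    (λ {A} {B} {D} D≈B A≈B → ≈ᶜ.trans {A} {B} {D} A≈B (≈ᶜ.sym {D} {B} D≈B))
    {filter (λ C → x ∈ᴸ? lits C) F} {C}
    (SetoidMembershipₚ.∈-filter⁺ clauseSetoid (λ C → x ∈ᴸ? lits C) (λ e → lhs≤rhs e) {C} {F} C∈ x∈)

  ∈-occurrences⁻ : ∀ C F x → C ∈ occurrences F x → C ∈ F × x ∈ᴸ lits C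
  ∈-occurrences⁻ C F x C∈ =
    SetoidMembershipₚ.∈-filter⁻ clauseSetoid (λ C → x ∈ᴸ? lits C) (λ e → lhs≤rhs e) {C} {F}
      (SetoidMembershipₚ.∈-deduplicate⁻ clauseSetoid _≈ᶜ?_ (filter (λ C → x ∈ᴸ? lits C) F) {C} C∈)

  single⁻ : ∀ F x → ldeg F x ≡ 1 → Single F x
  single⁻ F x e = go (occurrences F x) e (λ C → ∈-occurrences⁻ C F x) (λ C → ∈-occurrences⁺ C F x)
    where
    go : ∀ L → length L ≡ 1 → (∀ C → C ∈ L → C ∈ F × x ∈ᴸ lits C) →
      (∀ C → C ∈ F → x ∈ᴸ lits C → C ∈ L) → Single F x
    go (C ∷ []) _ ∈L⁻ ∈L⁺ = let C∈ , x∈ = ∈L⁻ C (here (≈ᶜ.refl {C})) in C , record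
      { main∈     = C∈
      ; x∈main    = x∈
      ; only-main = λ D D∈ x∈D → case ∈L⁺ D D∈ x∈D of λ { (here e) → e }
      }

  single⁺ : ∀ F x → Single F x → ldeg F x ≡ 1
  single⁺ F x (C , o) = go (occurrences F x) (deduplicate-! clauseDecSetoid _)
    (∈-occurrences⁺ C F x (main∈ o) (x∈main o)) (λ D → uncurry (only-main o D) ∘ ∈-occurrences⁻ D F x)
    where
    go : ∀ L → SetoidUnique.Unique clauseSetoid L → C ∈ L → (∀ D → D ∈ L → D ≈ᶜ C) → length L ≡ 1
    go (_ ∷ []) _ _ _ = refl
    go (A ∷ B ∷ L) ((A≉B ∷ _) ∷ _) _ ≈C = contradiction
      (≈ᶜ.trans {A} {C} {B} (≈C A (here (≈ᶜ.refl {A})))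
        (≈ᶜ.sym {B} {C} (≈C B (there (here (≈ᶜ.refl {B})))))) A≉B

  occurs⁻ : ∀ F x → 1 ≤ ldeg F x → Occurs F x
  occurs⁻ F x 1≤ = go (occurrences F x) 1≤ (λ C → ∈-occurrences⁻ C F x)
    where
    go : ∀ L → 1 ≤ length L → (∀ C → C ∈ L → C ∈ F × x ∈ᴸ lits C) → Occurs F x
    go (C ∷ L) _ ∈L⁻ = C , ∈L⁻ C (here (≈ᶜ.refl {C}))

  occurs⁺ : ∀ F x → Occurs F x → 1 ≤ ldeg F x
  occurs⁺ F x (C , C∈ , x∈) =
    SetoidMembershipₚ.∈-length clauseSetoid {C} (∈-occurrences⁺ C F x C∈ x∈)

  single? : ∀ F x → Dec (Single F x)
  single? F x = map′ (single⁻ F x) (single⁺ F x) (ldeg F x ℕₚ.≟ 1)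

  singularLit? : ∀ F x → Dec (SingularLit F x)
  singularLit? F x = single? F x ×-dec
    map′ (occurs⁻ F (comp x)) (occurs⁺ F (comp x)) (1 ℕₚ.≤? ldeg F (comp x))

  singular⁻ : ∀ F v → Singular F v → ∃ λ x → var x ≡ v × SingularLit F x
  singular⁻ F v s with ⊓≡1⁻ (ldeg F (pos v)) (ldeg F (neg v)) s
  ... | inj₁ (p , n) = pos v , refl , single⁻ F (pos v) p , occurs⁻ F (neg v) n
  ... | inj₂ (n , p) = neg v , refl , single⁻ F (neg v) n , occurs⁻ F (pos v) p

  singular⁺ : ∀ F x → SingularLit F x → Singular F (var x)
  singular⁺ F (pos v) (s , c) = trans (ℕₚ.m≤n⇒m⊓n≡m (ℕₚ.≤-trans
    (ℕₚ.≤-reflexive (single⁺ F (pos v) s)) (occurs⁺ F (neg v) c))) (single⁺ F (pos v) s)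
  singular⁺ F (neg v) (s , c) = trans (ℕₚ.m≥n⇒m⊓n≡n (ℕₚ.≤-trans
    (ℕₚ.≤-reflexive (single⁺ F (neg v) s)) (occurs⁺ F (pos v) c))) (single⁺ F (neg v) s)

  -- Singular DP-reduction of minimally unsatisfiable clause-sets

  resolvent-true : ∀ φ P Q E → Resolvent x P Q E →
    (∃ λ z → z ∈ᴸ lits P × value φ z ≡ true) → (∃ λ z → z ∈ᴸ lits Q × value φ z ≡ true) →
    ∃ λ z → z ∈ᴸ lits E × value φ z ≡ true
  resolvent-true {x} φ P Q E r (z , z∈ , e) (y , y∈ , d) with z ≟ᴸ x
  ... | no z≢x   = z , ∈⁺ˡ r z∈ z≢x , e
  ... | yes refl = y , ∈⁺ʳ r y∈ (λ { refl → value-consistent φ z e d }) , d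

  module SingularStep (F : ClauseSet) (mu : MU F) {x : Lit} (C : Clause) (o : Once F x C) where

    F/x : ClauseSet
    F/x = DP (var x) F

    parent≈main : ∀ P Q E → P ∈ F → Resolvent x P Q E → P ≈ᶜ C
    parent≈main P Q E P∈ r = only-main o P P∈ (x∈P r)

    main-resolvent : ∀ P Q E → P ∈ F → Resolvent x P Q E → Resolvent x C Q E
    main-resolvent P Q E P∈ r =
      resolvent-cong P Q C Q E E (parent≈main P Q E P∈ r) (≈ᶜ.refl {Q}) (≈ᶜ.refl {E}) r

    -- A model of `F/x` would extend to `F` by a choice at `var x`. For criticality, a witness for a
    -- suitable clause of `F` satisfies both parents of every resolvent other than the removed
    -- clause.
    MU-DP : MU F/x
    MU-DP = unsat , λ {E} → crit E
      where
      unsat : ¬ Satisfiable F/x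
      unsat (φ , s) with models-DP⁻ (var x) F (value-total φ) (λ C → s {C})
      ... | y , _ , m = unsat-upd y φ F (proj₁ mu) m

      crit : ∀ E → E ∈ F/x → Satisfiable (remove E F/x)
      crit E E∈ with DP⁻ x F E E∈
      ... | kept E∈F x∉ x̄∉ = let φ , m , _ = witness E F mu E∈F in
            φ , λ {G} G∈ → let G∈F/x , G≉E = ∈-remove⁻ E G F/x G∈ in
            case DP⁻ x F G G∈F/x of λ
              { (kept G∈F _ _) → m G G∈F G≉E
              ; (resolved P Q P∈ Q∈ r) → resolvent-true φ P Q G r
                  (m P P∈ λ P≈E → x∉ (lhs≤rhs P≈E (x∈P r)))
                  (m Q Q∈ λ Q≈E → x̄∉ (lhs≤rhs Q≈E (x̄∈Q r))) }
      -- The witness is taken for the side parent: the main clause is a parent of all resolvents,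
      -- whereas `Q` contributes nothing to `F/x` but `E`.
      ... | resolved P Q P∈ Q∈ r = let φ , m , _ = witness Q F mu Q∈ in
            φ , λ {G} G∈ → let G∈F/x , G≉E = ∈-remove⁻ E G F/x G∈ in
            case DP⁻ x F G G∈F/x of λ
              { (kept G∈F _ x̄∉) → m G G∈F λ G≈Q → x̄∉ (rhs≤lhs G≈Q (x̄∈Q r))
              ; (resolved P′ Q′ P′∈ Q′∈ r′) → resolvent-true φ P′ Q′ G r′
                  (m P′ P′∈ λ P′≈Q → noClash P′ (x∈P r′) (rhs≤lhs P′≈Q (x̄∈Q r)))
                  (m Q′ Q′∈ λ Q′≈Q → G≉E (resolvent-unique C Q G E
                    (resolvent-cong C Q′ C Q G G (≈ᶜ.refl {C}) Q′≈Q (≈ᶜ.refl {G})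
                      (main-resolvent P′ Q′ G P′∈ r′))
                    (main-resolvent P Q E P∈ r))) }

    -- An assignment satisfying all clauses but D could be flipped at x if it
    -- satisfied the main clause by a literal other than x.
    side-witness : ∀ D → D ∈ F → comp x ∈ᴸ lits D → ∃ λ φ →
      (∀ G → G ∈ F → ¬ G ≈ᶜ D → ∃ λ z → z ∈ᴸ lits G × value φ z ≡ true) ×
      Falsifies (value φ) D × (∀ {z} → z ∈ᴸ lits C → z ≢ x → value φ z ≡ false)
    side-witness D D∈ x̄∈D with witness D F mu D∈
    ... | φ , m , f = φ , m , f , λ {z} z∈C z≢x → ¬-not λ z-true →
          unsat-upd (comp x) φ F (proj₁ mu) λ G G∈ →
          case G ≈ᶜ? D of λ
            { (yes G≈D) → comp x , rhs≤lhs G≈D x̄∈D , upd-≡ (comp x) (value φ)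
            ; (no G≉D) → case x ∈ᴸ? lits G of λ
              { (yes x∈G) → z , rhs≤lhs (only-main o G G∈ x∈G) z∈C
                  , upd-true⁺ (comp x) (value φ) z-true (λ e → z≢x (trans e (comp-involutive x)))
              ; (no x∉G) → let y , y∈ , y-true = m G G∈ G≉D in
                  y , y∈ , upd-true⁺ (comp x) (value φ) y-true
                    (λ e → ∉⇒≢ x∉G y∈ (trans e (comp-involutive x))) } }

    -- The side witness falsifies `D` and all of the main clause except `x`; a second clash would
    -- make a literal and its complement false under an assignment.
    only-clash : ∀ D → D ∈ F → comp x ∈ᴸ lits D → z ∈ᴸ lits C → comp z ∈ᴸ lits D → z ≡ x
    only-clash {z} D D∈ x̄∈D z∈C z̄∈D = decidable-stable (z ≟ᴸ x) λ z≢x →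
      let φ , _ , f , g = side-witness D D∈ x̄∈D in value-total φ z (g z∈C z≢x) (f z̄∈D)

    side-resolvent : ∀ D → D ∈ F → comp x ∈ᴸ lits D → ∃ λ E → E ∈ F/x × Resolvent x C D E
    side-resolvent D D∈ x̄∈D = DP⁺ʳ x F C D (main∈ o) D∈ (x∈main o) x̄∈D (only-clash D D∈ x̄∈D)

    -- The map from clauses of F to clauses of the reduct

    -- The graph, up to `≈ᶜ`, of the map that resolves a clause with the main clause if it contains
    -- `comp x` and fixes it otherwise. `image` and `preimage` show that it reaches all of `F/x`.
    data Image (G E : Clause) : Set where
      unchanged : comp x ∉ᴸ lits G → E ≈ᶜ G → Image G E
      merged    : Resolvent x C G E → Image G E

    image : ∀ G → G ∈ F → x ∉ᴸ lits G → ∃ λ E → E ∈ F/x × Image G E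
    image G G∈ x∉ with comp x ∈ᴸ? lits G
    ... | yes x̄∈ = let E , E∈ , r = side-resolvent G G∈ x̄∈ in E , E∈ , merged r
    ... | no x̄∉  = G , DP⁺ᵏ x F G G∈ x∉ x̄∉ , unchanged x̄∉ (≈ᶜ.refl {G})

    image-∈ : ∀ G E → Image G E → z ∈ᴸ lits G → z ≢ comp x → z ∈ᴸ lits E
    image-∈ G E (unchanged _ E≈G) z∈ _ = rhs≤lhs E≈G z∈
    image-∈ G E (merged r) z∈ z≢x̄ = ∈⁺ʳ r z∈ z≢x̄

    preimage : ∀ E → E ∈ F/x → ∃ λ G → G ∈ F × Image G E
    preimage E E∈ with DP⁻ x F E E∈
    ... | kept E∈F _ x̄∉        = E , E∈F , unchanged x̄∉ (≈ᶜ.refl {E})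
    ... | resolved P Q P∈ Q∈ r = Q , Q∈ , merged (main-resolvent P Q E P∈ r)

    image-cong : ∀ G E G′ E′ → G ≈ᶜ G′ → Image G E → Image G′ E′ → E ≈ᶜ E′
    image-cong G E G′ E′ g (unchanged _ e) (unchanged _ e′) =
      ≈ᶜ.trans {E} {G} {E′} e (≈ᶜ.trans {G} {G′} {E′} g (≈ᶜ.sym {E′} {G′} e′))
    image-cong G E G′ E′ g (unchanged x̄∉ _) (merged r) = contradiction (rhs≤lhs g (x̄∈Q r)) x̄∉
    image-cong G E G′ E′ g (merged r) (unchanged x̄∉ _) = contradiction (lhs≤rhs g (x̄∈Q r)) x̄∉
    image-cong G E G′ E′ g (merged r) (merged r′) = resolvent-unique C G′ E E′
      (resolvent-cong C G C G′ E E (≈ᶜ.refl {C}) g (≈ᶜ.refl {E}) r) r′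

    -- The side witness for `G` falsifies both the rest of the main clause and `G`, hence all of
    -- `E`. It satisfies any other clause `G′` by a literal different from `comp x`, and that
    -- literal survives in `E′`.
    merged-injective : ∀ G E G′ E′ → G ∈ F → G′ ∈ F → Resolvent x C G E → Image G′ E′ →
      E ≈ᶜ E′ → G′ ≈ᶜ G
    merged-injective G E G′ E′ G∈ G′∈ r i E≈E′ with G′ ≈ᶜ? G
    ... | yes G′≈G = G′≈G
    ... | no G′≉G =
          let φ , m , f , g = side-witness G G∈ (x̄∈Q r)
              z , z∈ , z-true = m G′ G′∈ G′≉G
              z≢x̄ = true⇒≢false {σ = value φ} z-true (f (x̄∈Q r))
          in ⊥-elim (case ∈⁻ r (rhs≤lhs E≈E′ (image-∈ G′ E′ i z∈ z≢x̄)) of λ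
               { (inj₁ z∈C , z≢x , _) → true≢false z-true (g z∈C z≢x)
               ; (inj₂ z∈G , _)       → true≢false z-true (f z∈G) })

    image-injective : ∀ G E G′ E′ → G ∈ F → G′ ∈ F → Image G E → Image G′ E′ → E ≈ᶜ E′ → G ≈ᶜ G′
    image-injective G E G′ E′ G∈ G′∈ (merged r) i′ e =
      ≈ᶜ.sym {G′} {G} (merged-injective G E G′ E′ G∈ G′∈ r i′ e)
    image-injective G E G′ E′ G∈ G′∈ i@(unchanged _ _) (merged r) e =
      merged-injective G′ E′ G E G′∈ G∈ r i (≈ᶜ.sym {E} {E′} e)
    image-injective G E G′ E′ G∈ G′∈ (unchanged _ E≈G) (unchanged _ E′≈G′) e =
      ≈ᶜ.trans {G} {E} {G′} (≈ᶜ.sym {E} {G} E≈G) (≈ᶜ.trans {E} {E′} {G′} e E′≈G′)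

    -- Occurrences of literals after the step

    ∈-F/x⇒≢ : ∀ E → E ∈ F/x → z ∈ᴸ lits E → z ≢ x × z ≢ comp x
    ∈-F/x⇒≢ E E∈ z∈ with DP⁻ x F E E∈
    ... | kept _ x∉ x̄∉       = ∉⇒≢ x∉ z∈ , ∉⇒≢ x̄∉ z∈
    ... | resolved _ _ _ _ r = proj₂ (∈⁻ r z∈)

    occurs-DP⁻ : Occurs F/x z → Occurs F z
    occurs-DP⁻ (E , E∈ , z∈) with DP⁻ x F E E∈
    ... | kept E∈F _ _ = E , E∈F , z∈
    ... | resolved P Q P∈ Q∈ r with proj₁ (∈⁻ r z∈)
    ...   | inj₁ z∈P = P , P∈ , z∈P
    ...   | inj₂ z∈Q = Q , Q∈ , z∈Q

    -- The main clause has no image of its own; its literals survive in a resolvent, which exists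
    -- because `comp x` occurs.
    occurs-DP⁺ : Occurs F (comp x) → z ≢ x → z ≢ comp x → Occurs F z → Occurs F/x z
    occurs-DP⁺ (D , D∈ , x̄∈D) z≢x z≢x̄ (G , G∈ , z∈) with x ∈ᴸ? lits G
    ... | yes x∈G = let E , E∈ , r = side-resolvent D D∈ x̄∈D in
          E , E∈ , ∈⁺ˡ r (lhs≤rhs (only-main o G G∈ x∈G) z∈) z≢x
    ... | no x∉G  = let E , E∈ , i = image G G∈ x∉G in E , E∈ , image-∈ G E i z∈ z≢x̄

    -- Resolving adds only literals of the main clause, so the clauses of `F/x` containing `z` are
    -- exactly the images of those of `F` containing `z`.
    once-off-main : ∀ B → z ≢ comp x → z ∉ᴸ lits C → Once F z B → Single F/x z
    once-off-main {z} B z≢x̄ z∉C b = E , record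
      { main∈     = E∈
      ; x∈main    = image-∈ B E i (x∈main b) z≢x̄
      ; only-main = λ E′ E′∈ z∈E′ →
          let G , G∈ , i′ = preimage E′ E′∈ in
          image-cong G E′ B E (only-main b G G∈ (∈-preimage G E′ i′ z∈E′)) i′ i
      }
      where
      x∉B : x ∉ᴸ lits B
      x∉B x∈B = z∉C (lhs≤rhs (only-main o B (main∈ b) x∈B) (x∈main b))
      E = proj₁ (image B (main∈ b) x∉B)
      E∈ = proj₁ (proj₂ (image B (main∈ b) x∉B))
      i = proj₂ (proj₂ (image B (main∈ b) x∉B))
      ∈-preimage : ∀ G E → Image G E → z ∈ᴸ lits E → z ∈ᴸ lits G
      ∈-preimage G E (unchanged _ E≈G) z∈ = lhs≤rhs E≈G z∈
      ∈-preimage G E (merged r) z∈ = case proj₁ (∈⁻ r z∈) of λ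
        { (inj₁ z∈C) → contradiction z∈C z∉C ; (inj₂ z∈G) → z∈G }

    -- `z` lies only in the main clause, so no kept clause contains it, and with a single occurrence
    -- of `comp x` there is just one resolvent.
    once-on-main : z ≢ x → Once F z C → Single F (comp x) → Single F/x z
    once-on-main {z} z≢x oz (D , d) =
      let E , E∈ , r = side-resolvent D (main∈ d) (x∈main d) in E , record
      { main∈     = E∈
      ; x∈main    = ∈⁺ˡ r (x∈main oz) z≢x
      ; only-main = λ E′ E′∈ z∈E′ → case DP⁻ x F E′ E′∈ of λ
          { (kept E′∈F x∉ _) → contradiction (rhs≤lhs (only-main oz E′ E′∈F z∈E′) (x∈main o)) x∉
          ; (resolved P Q P∈ Q∈ r′) → resolvent-unique C D E′ E
              (resolvent-cong P Q C D E′ E′ (parent≈main P Q E′ P∈ r′)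
                (only-main d Q Q∈ (x̄∈Q r′)) (≈ᶜ.refl {E′}) r′) r }
      }

    -- Clauses of `F` containing `z` have images containing `z`; these images coincide, so
    -- injectivity identifies the clauses.
    once-DP⁻ : z ≢ x → z ∉ᴸ lits C → Single F/x z → Single F z
    once-DP⁻ {z} z≢x z∉C (E , e) with DP⁻ x F E (main∈ e)
    ... | kept E∈F x∉ x̄∉ = E , record
          { main∈ = E∈F ; x∈main = x∈main e ; only-main = λ D D∈ z∈D →
              let x∉D = λ x∈D → z∉C (lhs≤rhs (only-main o D D∈ x∈D) z∈D)
                  E′ , E′∈ , i = image D D∈ x∉D in
              image-injective D E′ E E D∈ E∈F i (unchanged x̄∉ (≈ᶜ.refl {E}))
                (only-main e E′ E′∈ (image-∈ D E′ i z∈D (proj₂ (∈-F/x⇒≢ E (main∈ e) (x∈main e))))) }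
    ... | resolved P Q P∈ Q∈ r = Q , record
          { main∈ = Q∈ ; x∈main = z∈Q ; only-main = λ D D∈ z∈D →
              let x∉D = λ x∈D → z∉C (lhs≤rhs (only-main o D D∈ x∈D) z∈D)
                  E′ , E′∈ , i = image D D∈ x∉D in
              image-injective D E′ Q E D∈ Q∈ i (merged (main-resolvent P Q E P∈ r))
                (only-main e E′ E′∈ (image-∈ D E′ i z∈D (proj₂ (∈-F/x⇒≢ E (main∈ e) (x∈main e))))) }
          where
          z∈Q : z ∈ᴸ lits Q
          z∈Q = case proj₁ (∈⁻ r (x∈main e)) of λ
            { (inj₁ z∈P) → contradiction (lhs≤rhs (parent≈main P Q E P∈ r) z∈P) z∉C
            ; (inj₂ z∈Q) → z∈Q }

    -- All resolvents contain the literals of the main clause, so z would occur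
    -- as often in F/x as comp x does in F.
    single-comp : z ≢ x → z ∈ᴸ lits C → Occurs F (comp x) → Single F/x z → Single F (comp x)
    single-comp z≢x z∈C (D , D∈ , x̄∈D) (E , e) = D , record
      { main∈ = D∈ ; x∈main = x̄∈D ; only-main = λ D′ D′∈ x̄∈D′ →
          let A , A∈ , r = side-resolvent D D∈ x̄∈D
              A′ , A′∈ , r′ = side-resolvent D′ D′∈ x̄∈D′
          in image-injective D′ A′ D A D′∈ D∈ (merged r′) (merged r)
               (≈ᶜ.trans {A′} {E} {A} (only-main e A′ A′∈ (∈⁺ˡ r′ z∈C z≢x))
                 (≈ᶜ.sym {A} {E} (only-main e A A∈ (∈⁺ˡ r z∈C z≢x)))) }

  -- Two singular literals obstruct each other only if they share their main
  -- clause and both complements occur more than once.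

  Independent Conflicting : ClauseSet → Lit → Lit → Set
  Independent F x y =
    (∀ C → C ∈ F → x ∈ᴸ lits C → y ∉ᴸ lits C) ⊎ Single F (comp x) ⊎ Single F (comp y)
  Conflicting F x y =
    (∃ λ C → C ∈ F × x ∈ᴸ lits C × y ∈ᴸ lits C) × ¬ Single F (comp x) × ¬ Single F (comp y)

  independent-sym : ∀ {F} → Independent F x y → Independent F y x
  independent-sym (inj₁ d)        = inj₁ λ C C∈ y∈ x∈ → d C C∈ x∈ y∈
  independent-sym (inj₂ (inj₁ s)) = inj₂ (inj₂ s)
  independent-sym (inj₂ (inj₂ s)) = inj₂ (inj₁ s)

  conflicting-sym : ∀ {F} → Conflicting F x y → Conflicting F y x
  conflicting-sym ((C , C∈ , x∈ , y∈) , ¬x̄ , ¬ȳ) = (C , C∈ , y∈ , x∈) , ¬ȳ , ¬x̄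

  -- The single clause of `y` is both the one shared with `x` and the one shared with `z`.
  conflicting-trans : ∀ {F} → Single F y → Conflicting F x y → Conflicting F y z → Conflicting F x z
  conflicting-trans (B , b) ((C , C∈ , x∈ , y∈) , ¬x̄ , _) ((D , D∈ , y∈′ , z∈) , _ , ¬z̄) =
    (C , C∈ , x∈ , rhs≤lhs (only-main b C C∈ y∈) (lhs≤rhs (only-main b D D∈ y∈′) z∈)) , ¬x̄ , ¬z̄

  independent? : ∀ F x → Single F x → ∀ y → Independent F x y ⊎ Conflicting F x y
  independent? F x (C , o) y with single? F (comp x) | single? F (comp y) | y ∈ᴸ? lits C
  ... | yes s | _     | _      = inj₁ (inj₂ (inj₁ s))
  ... | no _  | yes s | _      = inj₁ (inj₂ (inj₂ s))
  ... | no _  | no _  | no y∉C = inj₁ (inj₁ λ D D∈ x∈ y∈ → y∉C (lhs≤rhs (only-main o D D∈ x∈) y∈))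
  ... | no ¬x̄ | no ¬ȳ | yes y∈C = inj₂ ((C , main∈ o , x∈main o , y∈C) , ¬x̄ , ¬ȳ)

  once-at : ∀ F B C → Once F y B → C ∈ F → y ∈ᴸ lits C → Once F y C
  once-at F B C b C∈ y∈ = record
    { main∈ = C∈ ; x∈main = y∈ ; only-main = λ D D∈ y∈D →
        ≈ᶜ.trans {D} {B} {C} (only-main b D D∈ y∈D) (≈ᶜ.sym {C} {B} (only-main b C C∈ y∈)) }

  var-≢ : var x ≢ var y → x ≢ y × x ≢ comp y
  var-≢ {y = y} n = n ∘ cong var , λ e → n (trans (cong var e) (var-comp y))

  var-≢-comp : (x y : Lit) → var x ≢ var y → var (comp x) ≢ var y
  var-≢-comp x y n e = n (trans (sym (var-comp x)) e)

  -- Singularity after a reduction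

  -- Outside the main clause of `x`, `y` keeps its single occurrence. Inside it, `y` does so if
  -- `comp x` occurs once; if instead `comp y` occurs once, then `comp y` is off the main clause and
  -- takes over as the singular literal, so only the variable can be named in the conclusion.
  singular-persists : ∀ F → MU F → ∀ x y → SingularLit F x → SingularLit F y → var x ≢ var y →
    Independent F x y → Singular (DP (var x) F) (var y)
  singular-persists F mu x y ((C , o) , occ) ((B , b) , occ′) x≢y ind with y ∈ᴸ? lits C
  ... | no y∉C = singular⁺ _ y (once-off-main B (proj₂ (var-≢ (x≢y ∘ sym))) y∉C b
                   , occurs-DP⁺ occ (proj₁ ȳ≢) (proj₂ ȳ≢) occ′)
    where
    open SingularStep F mu C o
    ȳ≢ = var-≢ (var-≢-comp y x (x≢y ∘ sym))
  ... | yes y∈C with ind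
  ...   | inj₁ d = contradiction y∈C (d C (main∈ o) (x∈main o))
  ...   | inj₂ (inj₁ s) = singular⁺ _ y
            ( once-on-main (proj₁ (var-≢ (x≢y ∘ sym))) (once-at F B C b (main∈ o) y∈C) s
            , occurs-DP⁺ occ (proj₁ ȳ≢) (proj₂ ȳ≢) occ′)
    where
    open SingularStep F mu C o
    ȳ≢ = var-≢ (var-≢-comp y x (x≢y ∘ sym))
  ...   | inj₂ (inj₂ (D , d)) = subst (Singular F/x) (var-comp y) (singular⁺ _ (comp y)
            ( once-off-main D (proj₂ ȳ≢) (noClash C y∈C) d
            , subst (Occurs F/x) (sym (comp-involutive y))
                (occurs-DP⁺ occ (proj₁ y≢) (proj₂ y≢) (B , main∈ b , x∈main b))))
    where
    open SingularStep F mu C o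
    y≢ = var-≢ (x≢y ∘ sym)
    ȳ≢ = var-≢ (var-≢-comp y x (x≢y ∘ sym))

  -- A singular literal of the reduct that lies in the main clause would make `comp x` occur once,
  -- by `single-comp`. One outside it was singular in `F` already, and its conflict with `x` would
  -- place it in the main clause.
  DP-nonsingular : ∀ F → MU F → ∀ x → SingularLit F x → ¬ Single F (comp x) →
    (∀ z → SingularLit F z → Conflicting F x z) → Nonsingular (DP (var x) F)
  DP-nonsingular F mu x ((C , o) , occ) ¬x̄ conf v s with singular⁻ (DP (var x) F) v s
  ... | z , refl , (E , e) , occ-z̄ with z ∈ᴸ? lits C
  ...   | yes z∈C = ¬x̄ (single-comp (proj₁ (∈-F/x⇒≢ E (main∈ e) (x∈main e))) z∈C occ (E , e))
    where open SingularStep F mu C o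
  ...   | no z∉C with conf z (once-DP⁻ (proj₁ (∈-F/x⇒≢ E (main∈ e) (x∈main e))) z∉C (E , e) , occurs-DP⁻ occ-z̄)
    where open SingularStep F mu C o
  ...     | (D , D∈ , x∈D , z∈D) , _ = z∉C (lhs≤rhs (only-main o D D∈ x∈D) z∈D)

  -- Consequences of saturation

  -- `D` contains neither `y`, whose only clause contains `x`, nor `comp y`, which would be a second
  -- clash with `C`, so `D` belongs to the reduct at `y`. If `z` were missing from `D`, saturation
  -- at `D` and `z` would lead to a model of that reduct.
  saturated-side : ∀ F → MU F → ∀ x y C → Once F x C → Once F y C → x ≢ y → Occurs F (comp y) →
    Saturated (DP (var y) F) →
    ∀ D → D ∈ F → comp x ∈ᴸ lits D → z ∈ᴸ lits C → z ≢ x → z ≢ y → z ∈ᴸ lits D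
  saturated-side {z} F mu x y C ox oy x≢y (B , B∈ , ȳ∈B) sat D D∈ x̄∈D z∈C z≢x z≢y =
    decidable-stable (z ∈ᴸ? lits D) contra
    where
    module X = SingularStep F mu C ox
    module Y = SingularStep F mu C oy

    z̄∉D : comp z ∉ᴸ lits D
    z̄∉D z̄∈D = z≢x (X.only-clash D D∈ x̄∈D z∈C z̄∈D)
    y∉D : y ∉ᴸ lits D
    y∉D y∈D = noClash D (rhs≤lhs (only-main oy D D∈ y∈D) (x∈main ox)) x̄∈D
    ȳ∉D : comp y ∉ᴸ lits D
    ȳ∉D ȳ∈D = x≢y (sym (X.only-clash D D∈ x̄∈D (x∈main oy) ȳ∈D))
    D∈F/y : D ∈ Y.F/x
    D∈F/y = DP⁺ᵏ y F D D∈ y∉D ȳ∉D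

    -- If D is falsified then z is true, and x occurs in F/y only together with
    -- z, so x can be made false.
    contra : ¬ z ∉ᴸ lits D
    -- Saturation concerns only variables that occur; the resolvent of `C` and `B` on `y` shows that
    -- `var z` does.
    contra z∉D with Y.side-resolvent B B∈ ȳ∈B
    ... | E , E∈ , r with sat {D} D∈F/y z (∈-vars⁺ E Y.F/x E∈ (∈⁺ˡ r z∈C z≢y)) z∉vars
      where z∉vars = ∉-varsᶜ D z z∉D z̄∉D
    ...   | φ , s with satisfied? (value φ) (lits D)
    ...     | inj₁ (u , u∈ , u-true) = unsat-models φ Y.F/x (proj₁ Y.MU-DP) λ G G∈ → case G ≈ᶜ? D of λ
                { (yes G≈D) → u , rhs≤lhs G≈D u∈ , u-true
                ; (no G≉D)  → s {G} (there (∈-remove⁺ D G Y.F/x G∈ G≉D)) }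
    ...     | inj₂ f = unsat-upd (comp x) φ Y.F/x (proj₁ Y.MU-DP) models
      where
      z-true : value φ z ≡ true
      z-true with s {adjoin D z (∉-varsᶜ D z z∉D z̄∉D)} (here (≈ᶜ.refl {adjoin D z (∉-varsᶜ D z z∉D z̄∉D)}))
      ... | _ , here refl , t  = t
      ... | _ , there u∈D , t = contradiction (f u∈D) (true≢false t)

      models : Models (upd (comp x) (value φ)) Y.F/x
      models G G∈ with x ∈ᴸ? lits G | G ≈ᶜ? D
      ... | _ | yes G≈D = comp x , rhs≤lhs G≈D x̄∈D , upd-≡ (comp x) (value φ)
      ... | no x∉G | no G≉D with s {G} (there (∈-remove⁺ D G Y.F/x G∈ G≉D))
      ...   | u , u∈ , t = u , u∈ , upd-true⁺ (comp x) (value φ) t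
                (λ e → ∉⇒≢ x∉G u∈ (trans e (comp-involutive x)))
      -- The only clause of `F` containing `x` is `C`, which contains `y` and is not kept, so `G` is
      -- a resolvent of `C` on `y` and inherits `z`.
      models G G∈ | yes x∈G | no _ with DP⁻ y F G G∈
      ...   | kept G∈F y∉G _ = contradiction (rhs≤lhs (only-main ox G G∈F x∈G) (x∈main oy)) y∉G
      ...   | resolved P Q P∈ _ r′ = z , ∈⁺ˡ r′ (rhs≤lhs (Y.parent≈main P Q G P∈ r′) z∈C) z≢y
                , upd-true⁺ (comp x) (value φ) z-true (λ e → z≢x (trans e (comp-involutive x)))

  -- Isomorphism

  swap : Lit → Lit → Lit → Lit
  swap x y z =
    if does (z ≟ᴸ x) then comp y else
    if does (z ≟ᴸ comp y) then x else
    if does (z ≟ᴸ comp x) then y else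
    if does (z ≟ᴸ y) then comp x else z

  swap-x : ∀ x y → swap x y x ≡ comp y
  swap-x x y rewrite dec-true (x ≟ᴸ x) refl = refl

  swap-ȳ : ∀ x y → var x ≢ var y → swap x y (comp y) ≡ x
  swap-ȳ x y n
    rewrite dec-false (comp y ≟ᴸ x) (proj₂ (var-≢ n) ∘ sym)
          | dec-true (comp y ≟ᴸ comp y) refl = refl

  swap-x̄ : ∀ x y → var x ≢ var y → swap x y (comp x) ≡ y
  swap-x̄ x y n
    rewrite dec-false (comp x ≟ᴸ x) (comp≢ x)
          | dec-false (comp x ≟ᴸ comp y) (proj₁ (var-≢ n) ∘ comp-injective)
          | dec-true (comp x ≟ᴸ comp x) refl = refl

  swap-y : ∀ x y → var x ≢ var y → swap x y y ≡ comp x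
  swap-y x y n
    rewrite dec-false (y ≟ᴸ x) (proj₁ (var-≢ n) ∘ sym)
          | dec-false (y ≟ᴸ comp y) (comp≢ y ∘ sym)
          | dec-false (y ≟ᴸ comp x) (proj₂ (var-≢ (n ∘ sym)))
          | dec-true (y ≟ᴸ y) refl = refl

  swap-other : ∀ x y z → z ≢ x → z ≢ comp x → z ≢ y → z ≢ comp y → swap x y z ≡ z
  swap-other x y z z≢x z≢x̄ z≢y z≢ȳ
    rewrite dec-false (z ≟ᴸ x) z≢x | dec-false (z ≟ᴸ comp y) z≢ȳ
          | dec-false (z ≟ᴸ comp x) z≢x̄ | dec-false (z ≟ᴸ y) z≢y = refl

  data SwapView (x y : Lit) : Lit → Set where
    is-x  : SwapView x y x
    is-x̄  : SwapView x y (comp x)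
    is-y  : SwapView x y y
    is-ȳ  : SwapView x y (comp y)
    other : ∀ {z} → z ≢ x → z ≢ comp x → z ≢ y → z ≢ comp y → SwapView x y z

  swapView : ∀ x y z → SwapView x y z
  swapView x y z with z ≟ᴸ x | z ≟ᴸ comp x | z ≟ᴸ y | z ≟ᴸ comp y
  ... | yes refl | _        | _        | _        = is-x
  ... | no _     | yes refl | _        | _        = is-x̄
  ... | no _     | no _     | yes refl | _        = is-y
  ... | no _     | no _     | no _     | yes refl = is-ȳ
  ... | no a     | no b     | no c     | no d     = other a b c d

  -- The inverse is written `swap y x`, so that the backward half of the isomorphism is `swap-image`
  -- with `x` and `y` exchanged.
  swap-inverse : ∀ x y → var x ≢ var y → ∀ z → swap x y (swap y x z) ≡ z
  swap-inverse x y n z with swapView x y z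
  ... | is-x = trans (cong (swap x y) (swap-y y x (n ∘ sym))) (swap-ȳ x y n)
  ... | is-x̄ = trans (cong (swap x y) (swap-ȳ y x (n ∘ sym))) (swap-y x y n)
  ... | is-y = trans (cong (swap x y) (swap-x y x)) (swap-x̄ x y n)
  ... | is-ȳ = trans (cong (swap x y) (swap-x̄ y x (n ∘ sym))) (swap-x x y)
  ... | other a b c d = trans (cong (swap x y) (swap-other y x z c d a b)) (swap-other x y z a b c d)

  swap-comp : ∀ x y → var x ≢ var y → ∀ z → swap x y (comp z) ≡ comp (swap x y z)
  swap-comp x y n z with swapView x y z
  ... | is-x = trans (swap-x̄ x y n) (trans (sym (comp-involutive y)) (cong comp (sym (swap-x x y))))
  ... | is-x̄ = trans (cong (swap x y) (comp-involutive x)) (trans (swap-x x y) (cong comp (sym (swap-x̄ x y n))))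
  ... | is-y = trans (swap-ȳ x y n) (trans (sym (comp-involutive x)) (cong comp (sym (swap-y x y n))))
  ... | is-ȳ = trans (cong (swap x y) (comp-involutive y)) (trans (swap-y x y n) (cong comp (sym (swap-ȳ x y n))))
  ... | other a b c d = trans
        (swap-other x y (comp z) (b ∘ ≡-comp) (a ∘ comp-injective) (d ∘ ≡-comp) (c ∘ comp-injective))
        (cong comp (sym (swap-other x y z a b c d)))

  swapping : ∀ x y → var x ≢ var y → Renaming
  swapping x y n = record
    { bijection = mk↔ₛ′ (swap x y) (swap y x) (swap-inverse x y n) (swap-inverse y x (n ∘ sym))
    ; to-comp   = swap-comp x y n
    }

  map-inverse : ∀ {xs ys} (f g : Lit → Lit) → (∀ z → f (g z) ≡ z) → (∀ z → g (f z) ≡ z) →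
    xs ≈ᴸ map f ys → ys ≈ᴸ map g xs
  map-inverse {xs} {ys} f g fg gf e =
      (λ {z} z∈ → subst (_∈ᴸ map g xs) (gf z) (∈-map⁺ g (rhs≤lhs e (∈-map⁺ f z∈))))
    , λ z∈ → case ∈-map⁻ g z∈ of λ { (u , u∈ , refl) → case ∈-map⁻ f (lhs≤rhs e u∈) of λ
        { (w , w∈ , refl) → subst (_∈ᴸ ys) (sym (gf w)) w∈ } }

  map-compose : ∀ {xs ys zs} (f g : Lit → Lit) → ys ≈ᴸ map f xs → zs ≈ᴸ map g ys → zs ≈ᴸ map (g ∘ f) xs
  map-compose {xs} {ys} {zs} f g p q =
      (λ z∈ → case ∈-map⁻ g (lhs≤rhs q z∈) of λ { (u , u∈ , refl) → case ∈-map⁻ f (lhs≤rhs p u∈) of λ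
        { (w , w∈ , refl) → ∈-map⁺ (g ∘ f) w∈ } })
    , λ z∈ → case ∈-map⁻ (g ∘ f) z∈ of λ { (w , w∈ , refl) →
        rhs≤lhs q (∈-map⁺ g (rhs≤lhs p (∈-map⁺ f w∈))) }

  -- Unlike Isomorphic, this does not mention the renamed clauses themselves.
  MapsOnto : (Lit → Lit) → ClauseSet → ClauseSet → Set
  MapsOnto f F G =
    (∀ C → C ∈ F → ∃ λ D → D ∈ G × lits D ≈ᴸ map f (lits C)) ×
    (∀ D → D ∈ G → ∃ λ C → C ∈ F × lits D ≈ᴸ map f (lits C))

  isomorphic⁺ : ∀ F G ρ → MapsOnto (Renaming.to ρ) F G → Isomorphic F G
  isomorphic⁺ F G ρ (forth , back) = ρ
    , (λ {E} E∈ → let C , C∈ , E≈ρC = find (Anyₚ.map⁻ E∈)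
                      D , D∈ , D≈ρC = forth C (≡⇒∈ C F C∈) in
        ∈-resp D E G (≈ᶜ.trans {D} {rename C} {E} D≈ρC (≈ᶜ.sym {E} {rename C} E≈ρC)) D∈)
    , (λ {D} D∈ → let C , C∈ , D≈ρC = back D D∈
                      C′ , C′∈ , C≈C′ = find C∈ in
        Anyₚ.map⁺ (lose C′∈ (≈ᶜ.trans {D} {rename C} {rename C′} D≈ρC (rename-cong C C′ C≈C′))))
    where
    open Renaming ρ
    rename-⊆ : ∀ C C′ → C ≈ᶜ C′ → z ∈ᴸ lits (rename C) → z ∈ᴸ lits (rename C′)
    rename-⊆ C C′ e z∈ = case ∈-map⁻ to z∈ of λ { (u , u∈ , refl) → ∈-map⁺ to (lhs≤rhs e u∈) }
    rename-cong : ∀ C C′ → C ≈ᶜ C′ → rename C ≈ᶜ rename C′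
    rename-cong C C′ e = rename-⊆ C C′ e , rename-⊆ C′ C (≈ᶜ.sym {C} {C′} e)

  isomorphic⁻ : ∀ F G (i : Isomorphic F G) → MapsOnto (Renaming.to (proj₁ i)) F G
  isomorphic⁻ F G (ρ , e) =
      (λ C C∈ → let C′ , C′∈ , C≈C′ = find C∈ in
         rename C′ , lhs≤rhs e {rename C′} (Anyₚ.map⁺ (lose C′∈ (≈ᶜ.refl {rename C′})))
         , (λ z∈ → case ∈-map⁻ to z∈ of λ { (u , u∈ , refl) → ∈-map⁺ to (rhs≤lhs C≈C′ u∈) })
         , (λ z∈ → case ∈-map⁻ to z∈ of λ { (u , u∈ , refl) → ∈-map⁺ to (lhs≤rhs C≈C′ u∈) }))
    , λ D D∈ → let C , C∈ , D≈ρC = find (Anyₚ.map⁻ (rhs≤lhs e {D} D∈)) in C , ≡⇒∈ C F C∈ , D≈ρC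
    where open Renaming ρ

  ≈⇒isomorphic : ∀ F G → F ≈ G → Isomorphic F G
  ≈⇒isomorphic F G e = isomorphic⁺ F G identity
    ( (λ C C∈ → C , lhs≤rhs e {C} C∈ , map-id)
    , (λ D D∈ → D , rhs≤lhs e {D} D∈ , map-id) )
    where
    identity : Renaming
    identity = record { bijection = mk↔ₛ′ id id (λ _ → refl) (λ _ → refl) ; to-comp = λ _ → refl }
    map-id : ∀ {xs} → xs ≈ᴸ map id xs
    map-id = ∈-map⁺ id , λ z∈ → case ∈-map⁻ id z∈ of λ { (_ , u∈ , refl) → u∈ }

  isomorphic-trans : ∀ F G H → Isomorphic F G → Isomorphic G H → Isomorphic F H
  isomorphic-trans F G H i@(ρ , _) j@(π , _) = isomorphic⁺ F H
    (record
      { bijection = Renaming.bijection π ↔-∘ Renaming.bijection ρ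
      ; to-comp   = λ x → trans (cong (Renaming.to π) (Renaming.to-comp ρ x)) (Renaming.to-comp π _)
      })
    ( (λ C C∈ → let D , D∈ , p = proj₁ (isomorphic⁻ F G i) C C∈
                    E , E∈ , q = proj₁ (isomorphic⁻ G H j) D D∈
                in E , E∈ , map-compose (Renaming.to ρ) (Renaming.to π) p q)
    , (λ E E∈ → let D , D∈ , q = proj₂ (isomorphic⁻ G H j) E E∈
                    C , C∈ , p = proj₂ (isomorphic⁻ F G i) D D∈
                in C , C∈ , map-compose (Renaming.to ρ) (Renaming.to π) p q) )

  -- The isomorphism between two conflicting reducts

  -- Since the rest of `C` lies in every side clause, a resolvent of `C` merely replaces one literal
  -- of its side parent: `comp x` by `y`, or `comp y` by `x`. The swap undoes the first replacement,
  -- performs the second, and fixes all other clauses.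
  swap-image : ∀ F → MU F → ∀ x y C → Once F x C → Once F y C → var x ≢ var y →
    (∀ {z} D → D ∈ F → comp x ∈ᴸ lits D → z ∈ᴸ lits C → z ≢ x → z ≢ y → z ∈ᴸ lits D) →
    (∀ {z} D → D ∈ F → comp y ∈ᴸ lits D → z ∈ᴸ lits C → z ≢ y → z ≢ x → z ∈ᴸ lits D) →
    ∀ E → E ∈ DP (var x) F → ∃ λ E′ → E′ ∈ DP (var y) F × lits E′ ≈ᴸ map (swap x y) (lits E)
  swap-image F mu x y C ox oy n C⊆x-side C⊆y-side E E∈ with DP⁻ x F E E∈
  ... | kept E∈F x∉E x̄∉E = go (comp y ∈ᴸ? lits E)
    where
    module Y = SingularStep F mu C oy
    y∉E : y ∉ᴸ lits E
    y∉E y∈E = x∉E (rhs≤lhs (only-main oy E E∈F y∈E) (x∈main ox))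

    fixed : z ∈ᴸ lits E → z ≢ comp y → swap x y z ≡ z
    fixed z∈ z≢ȳ = swap-other x y _ (∉⇒≢ x∉E z∈) (∉⇒≢ x̄∉E z∈) (∉⇒≢ y∉E z∈) z≢ȳ

    go : Dec (comp y ∈ᴸ lits E) →
      ∃ λ E′ → E′ ∈ DP (var y) F × lits E′ ≈ᴸ map (swap x y) (lits E)
    go (no ȳ∉E) = E , DP⁺ᵏ y F E E∈F y∉E ȳ∉E
      , (λ z∈ → subst (_∈ᴸ _) (fixed z∈ (∉⇒≢ ȳ∉E z∈)) (∈-map⁺ (swap x y) z∈))
      , λ z∈ → case ∈-map⁻ (swap x y) z∈ of λ
          { (u , u∈ , refl) → subst (_∈ᴸ lits E) (sym (fixed u∈ (∉⇒≢ ȳ∉E u∈))) u∈ }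
    -- `E` is a side clause for `y`; its resolvent with `C` on `y` is `E` with `comp y` turned into
    -- `x`.
    go (yes ȳ∈E) = let E′ , E′∈ , r = Y.side-resolvent E E∈F ȳ∈E in E′ , E′∈
      , (λ {z} z∈ → case z ≟ᴸ x of λ
          { (yes refl) → subst (_∈ᴸ map (swap x y) (lits E)) (swap-ȳ x y n) (∈-map⁺ (swap x y) ȳ∈E)
          ; (no z≢x) → case ∈⁻ r z∈ of λ { (z∈CE , z≢y , z≢ȳ) →
              let z∈E = [ (λ z∈C → C⊆y-side E E∈F ȳ∈E z∈C z≢y z≢x) , id ]′ z∈CE in
              subst (_∈ᴸ map (swap x y) (lits E)) (fixed z∈E z≢ȳ) (∈-map⁺ (swap x y) z∈E) } })
      , λ z∈ → case ∈-map⁻ (swap x y) z∈ of λ { (u , u∈ , refl) → case u ≟ᴸ comp y of λ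
          { (yes refl) → subst (_∈ᴸ lits E′) (sym (swap-ȳ x y n))
              (∈⁺ˡ r (x∈main ox) (proj₁ (var-≢ n)))
          ; (no u≢ȳ) → subst (_∈ᴸ lits E′) (sym (fixed u∈ u≢ȳ)) (∈⁺ʳ r u∈ u≢ȳ) } }
  -- The image is the side parent itself, which contains neither `y` nor `comp y` and is therefore
  -- kept at `y`.
  ... | resolved P Q P∈ Q∈ r₀ = Q , DP⁺ᵏ y F Q Q∈ y∉Q ȳ∉Q
      , (λ {z} z∈ → case z ≟ᴸ comp x of λ
          { (yes refl) → subst (_∈ᴸ map (swap x y) (lits E)) (swap-y x y n)
              (∈-map⁺ (swap x y) (∈⁺ˡ r (x∈main oy) (proj₁ (var-≢ (n ∘ sym)))))
          ; (no z≢x̄) → subst (_∈ᴸ map (swap x y) (lits E)) (fixed z∈ z≢x̄) (∈-map⁺ (swap x y) (∈⁺ʳ r z∈ z≢x̄)) })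
      , λ z∈ → case ∈-map⁻ (swap x y) z∈ of λ { (u , u∈ , refl) → case u ≟ᴸ y of λ
          { (yes refl) → subst (_∈ᴸ lits Q) (sym (swap-y x y n)) (x̄∈Q r)
          ; (no u≢y) → case ∈⁻ r u∈ of λ { (u∈CQ , u≢x , u≢x̄) →
              let u∈Q = [ (λ u∈C → C⊆x-side Q Q∈ (x̄∈Q r) u∈C u≢x u≢y) , id ]′ u∈CQ in
              subst (_∈ᴸ lits Q) (sym (fixed u∈Q u≢x̄)) u∈Q } } }
    where
    module X = SingularStep F mu C ox
    r : Resolvent x C Q E
    r = X.main-resolvent P Q E P∈ r₀
    x∉Q : x ∉ᴸ lits Q
    x∉Q x∈Q = noClash Q x∈Q (x̄∈Q r)
    y∉Q : y ∉ᴸ lits Q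
    y∉Q y∈Q = x∉Q (rhs≤lhs (only-main oy Q Q∈ y∈Q) (x∈main ox))
    ȳ∉Q : comp y ∉ᴸ lits Q
    ȳ∉Q ȳ∈Q = proj₁ (var-≢ (n ∘ sym)) (X.only-clash Q Q∈ (x̄∈Q r) (x∈main oy) ȳ∈Q)
    fixed : z ∈ᴸ lits Q → z ≢ comp x → swap x y z ≡ z
    fixed z∈ z≢x̄ = swap-other x y _ (∉⇒≢ x∉Q z∈) z≢x̄ (∉⇒≢ y∉Q z∈) (∉⇒≢ ȳ∉Q z∈)

  conflicting⇒isomorphic : ∀ F → MU F → ∀ x y → SingularLit F x → SingularLit F y →
    var x ≢ var y → Conflicting F x y → Saturated (DP (var x) F) → Saturated (DP (var y) F) →
    Isomorphic (DP (var x) F) (DP (var y) F)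
  conflicting⇒isomorphic F mu x y ((A , a) , x̄-occ) ((B , b) , ȳ-occ) n
    ((C , C∈ , x∈C , y∈C) , _) satˣ satʸ =
    isomorphic⁺ _ _ (swapping x y n)
      ( swap-image F mu x y C ox oy n C⊆x-side C⊆y-side
      , λ D D∈ → let E , E∈ , e = swap-image F mu y x C oy ox (n ∘ sym) C⊆y-side C⊆x-side D D∈ in
          E , E∈ , map-inverse (swap y x) (swap x y)
            (swap-inverse y x (n ∘ sym)) (swap-inverse x y n) e )
    where
    ox : Once F x C
    ox = once-at F A C a C∈ x∈C
    oy : Once F y C
    oy = once-at F B C b C∈ y∈C
    -- Clauses containing `comp x` survive the reduction at `y`, so it is the saturation of that
    -- reduct which constrains them; likewise with `x` and `y` exchanged.
    C⊆x-side : ∀ {z} D → D ∈ F → comp x ∈ᴸ lits D → z ∈ᴸ lits C → z ≢ x → z ≢ y → z ∈ᴸ lits D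
    C⊆x-side = saturated-side F mu x y C ox oy (proj₁ (var-≢ n)) ȳ-occ λ {D} → satʸ {D}
    C⊆y-side : ∀ {z} D → D ∈ F → comp y ∈ᴸ lits D → z ∈ᴸ lits C → z ≢ y → z ≢ x → z ∈ᴸ lits D
    C⊆y-side = saturated-side F mu y x C oy ox (proj₁ (var-≢ (n ∘ sym))) x̄-occ λ {D} → satˣ {D}

  -- Invariance under ≈

  once-cong : ∀ F G C → F ≈ G → Once F x C → Once G x C
  once-cong F G C e o = record
    { main∈     = lhs≤rhs e {C} (main∈ o)
    ; x∈main    = x∈main o
    ; only-main = λ D D∈ → only-main o D (rhs≤lhs e {D} D∈)
    }

  singular-cong : ∀ F G → F ≈ G → Singular F v → Singular G v
  singular-cong F G e s with singular⁻ F _ s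
  ... | x , refl , (C , o) , (D , D∈ , x̄∈) =
        singular⁺ G x ((C , once-cong F G C e o) , (D , lhs≤rhs e {D} D∈ , x̄∈))

  MU-cong : ∀ F G → F ≈ G → MU F → MU G
  MU-cong F G e (unsat , crit) =
      (λ { (φ , s) → unsat (φ , λ {C} C∈ → s {C} (lhs≤rhs e {C} C∈)) })
    , λ {C} C∈ → let φ , s = crit {C} (rhs≤lhs e {C} C∈) in φ , λ {D} D∈ →
        let D∈G , D≉C = ∈-remove⁻ C D G D∈ in s {D} (∈-remove⁺ C D F (rhs≤lhs e {D} D∈G) D≉C)

  DP-mono : ∀ v F G → (∀ C → C ∈ F → C ∈ G) → ∀ E → E ∈ DP v F → E ∈ DP v G
  DP-mono v F G F⊆G E E∈ with DP⁻ (pos v) F E E∈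
  ... | kept E∈F v∉ v̄∉ = DP⁺ᵏ (pos v) G E (F⊆G E E∈F) v∉ v̄∉
  ... | resolved P Q P∈ Q∈ r =
        let E′ , E′∈ , r′ = DP⁺ʳ (pos v) G P Q (F⊆G P P∈) (F⊆G Q Q∈) (x∈P r) (x̄∈Q r) (only r) in
        ∈-resp E′ E (DP v G) (resolvent-unique P Q E′ E r′ r) E′∈

  DP-cong : ∀ v F G → F ≈ G → DP v F ≈ DP v G
  DP-cong v F G e =
      (λ {E} → DP-mono v F G (λ C → lhs≤rhs e {C}) E)
    , (λ {E} → DP-mono v G F (λ C → rhs≤lhs e {C}) E)

  -- `DP-comm` holds only up to `≈`, so reduction sequences must be transported to an equivalent
  -- start, with an equivalent end.
  star-cong : ∀ {F F′} G → F ≈ G → Star _⇝_ F F′ → ∃ λ G′ → Star _⇝_ G G′ × F′ ≈ G′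
  star-cong G e ε = G , ε , e
  star-cong {F} G e (step {v} mu s ◅ steps) =
    let G′ , steps′ , e′ = star-cong (DP v G) (DP-cong v F G e) steps in
    G′ , step (MU-cong F G e mu) (singular-cong F G e s) ◅ steps′ , e′

  sDP-cong : ∀ F F′ G → F ≈ G → F′ ∈sDP F → ∃ λ G′ → G′ ∈sDP G × F′ ≈ G′
  sDP-cong F F′ G e (mu , ns , steps) =
    let G′ , steps′ , e′ = star-cong G e steps in
    G′ , (MU-cong F′ G′ e′ mu
         , (λ v s → ns v (singular-cong G′ F′ ((λ {C} → rhs≤lhs e′ {C}) , (λ {C} → lhs≤rhs e′ {C})) s)) , steps′) , e′

  -- Confluence

  MU-step : ∀ F → MU F → Singular F v → MU (DP v F)
  MU-step F mu s with singular⁻ F _ s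
  ... | x , refl , (C , o) , _ = SingularStep.MU-DP F mu C o

  sDP-step : ∀ F H → MU F → Singular F v → H ∈sDP DP v F → H ∈sDP F
  sDP-step F H mu s (mu′ , ns , steps) = mu′ , ns , step mu s ◅ steps

  nonsingular-sDP : ∀ F H → Nonsingular F → H ∈sDP F → F ≡ H
  nonsingular-sDP F H ns (_ , _ , ε)          = refl
  nonsingular-sDP F H ns (_ , _ , step _ s ◅ _) = contradiction s (ns _)

  singular-∈vars : ∀ F → Singular F v → v ∈ⱽ vars F
  singular-∈vars F s with singular⁻ F _ s
  ... | x , refl , (C , o) , _ = ∈-vars⁺ C F (main∈ o) (x∈main o)

  vars-DP : ∀ v F → w ∈ⱽ vars (DP v F) → w ∈ⱽ vars F × w ≢ v
  vars-DP v F w∈ with ∈-vars⁻ (DP v F) w∈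
  ... | z , E , refl , E∈ , z∈ with DP⁻ (pos v) F E E∈
  ...   | kept E∈F v∉ v̄∉ = ∈-vars⁺ E F E∈F z∈ , λ e →
          [ ∉⇒≢ v∉ z∈ , ∉⇒≢ v̄∉ z∈ ]′ (var-≡ z (pos v) e)
  ...   | resolved P Q P∈ Q∈ r with ∈⁻ r z∈
  ...     | z∈PQ , z≢v , z≢v̄ = [ ∈-vars⁺ P F P∈ , ∈-vars⁺ Q F Q∈ ]′ z∈PQ
            , λ e → [ z≢v , z≢v̄ ]′ (var-≡ z (pos v) e)

  -- Termination and normal forms

  -- `vars F` has repetitions, and resolution may lengthen it. A list covering the variables does
  -- decrease, since the eliminated variable can be deleted from it.
  Bounded : ℕ → ClauseSet → Set
  Bounded n F = ∃ λ L → (∀ {w} → w ∈ⱽ vars F → w ∈ⱽ L) × length L < n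

  bounded-step : ∀ {n} F → Bounded (suc n) F → Singular F v → Bounded n (DP v F)
  bounded-step {v} F (L , vars⊆L , s≤s L≤n) s =
      filter (λ w → ¬? (w ≟ v)) L
    , (λ w∈ → let w∈F , w≢v = vars-DP v F w∈ in ∈-filter⁺ (λ w → ¬? (w ≟ v)) (vars⊆L w∈F) w≢v)
    , ℕₚ.<-≤-trans (filter-notAll (λ w → ¬? (w ≟ v)) L
        (Any.map (λ v≡w w≢v → w≢v (sym v≡w)) (vars⊆L (singular-∈vars F s)))) L≤n

  normal-form : ∀ n F → Bounded n F → MU F → ∃ λ H → H ∈sDP F
  normal-form zero F (_ , _ , ()) mu
  normal-form (suc n) F b mu
    -- Searching `vars F` suffices, as a singular variable occurs in `F`.
    with Any.any? (λ v → ldeg F (pos v) ⊓ ldeg F (neg v) ℕₚ.≟ 1) (vars F)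
  ... | no ¬s = F , mu , (λ v s → ¬s (lose (singular-∈vars F s) s)) , ε
  ... | yes a = let v , _ , s = find a
                    H , H∈ = normal-form n (DP v F) (bounded-step F b s) (MU-step F mu s)
                in H , sDP-step F H mu s H∈

  bounded : ∀ F → Bounded (suc (length (vars F))) F
  bounded F = vars F , id , ℕₚ.≤-refl

  normalise : ∀ F → MU F → ∃ λ H → H ∈sDP F
  normalise F = normal-form _ F (bounded F)

  -- Joining two first steps

  Confluent : ClauseSet → Set
  Confluent F = ∀ G H → G ∈sDP F → H ∈sDP F → Isomorphic G H

  module Join (F : ClauseSet) (mu : MU F) (es : EventuallySaturated F)
              (IH : ∀ v → Singular F v → Confluent (DP v F)) where

    -- Each reduct can be reduced at the other variable, and the two results agree up to `≈`. A
    -- normal form `N` of one, transported to `N′` for the other, is compared with `G` and `H` by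
    -- the induction hypothesis.
    join-independent : ∀ x y → SingularLit F x → SingularLit F y → Independent F x y →
      ∀ G H → G ∈sDP DP (var x) F → H ∈sDP DP (var y) F → Isomorphic G H
    join-independent x y sx sy ind G H G∈ H∈ with var x ≟ var y
    ... | yes e = IH (var x) (singular⁺ F x sx) G H G∈ (subst (λ v → H ∈sDP DP v F) (sym e) H∈)
    ... | no n = isomorphic-trans G N H
          (IH (var x) (singular⁺ F x sx) G N G∈ (sDP-step _ N muˣ sʸ N∈))
          (isomorphic-trans N N′ H (≈⇒isomorphic N N′ (proj₂ (proj₂ transferred)))
            (IH (var y) (singular⁺ F y sy) N′ H
              (sDP-step _ N′ muʸ sˣ (proj₁ (proj₂ transferred))) H∈))
      where
      muˣ = MU-step F mu (singular⁺ F x sx)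
      muʸ = MU-step F mu (singular⁺ F y sy)
      sʸ = singular-persists F mu x y sx sy n ind
      sˣ = singular-persists F mu y x sy sx (n ∘ sym) (independent-sym {F = F} ind)
      muʸˣ = MU-step _ muˣ sʸ
      muˣʸ = MU-step _ muʸ sˣ
      N = proj₁ (normalise (DP (var y) (DP (var x) F)) muʸˣ)
      N∈ = proj₂ (normalise (DP (var y) (DP (var x) F)) muʸˣ)
      transferred = sDP-cong _ N _ (DP-comm (var y) (var x) F (n ∘ sym) muʸˣ muˣʸ) N∈
      N′ = proj₁ transferred

    join : ∀ x y → SingularLit F x → SingularLit F y →
      ∀ G H → G ∈sDP DP (var x) F → H ∈sDP DP (var y) F → Isomorphic G H
    join x y sx sy G H G∈ H∈ with independent? F x (proj₁ sx) y
    ... | inj₁ ind = join-independent x y sx sy ind G H G∈ H∈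
    ... | inj₂ conf with var x ≟ var y
    ...   | yes e = IH (var x) (singular⁺ F x sx) G H G∈ (subst (λ v → H ∈sDP DP v F) (sym e) H∈)
    -- A singular literal occurs in its main clause, so the literals of `F` include every candidate
    -- for a third one.
    ...   | no n with All.decide third? (concatMap lits F)
      where
      third? : ∀ z → (SingularLit F z → Conflicting F x z) ⊎
        (SingularLit F z × Independent F x z × Independent F y z)
      third? z with singularLit? F z
      ... | no ¬sz = inj₁ λ sz → contradiction sz ¬sz
      ... | yes sz with independent? F x (proj₁ sx) z | independent? F y (proj₁ sy) z
      ...   | inj₁ i | inj₁ j = inj₂ (sz , i , j)
      ...   | inj₂ c | _      = inj₁ λ _ → c
      -- A literal in conflict with `y` is in conflict with `x` too, so this candidate does not
      -- help.
      ...   | inj₁ i | inj₂ c = inj₁ λ _ → conflicting-trans {F = F} (proj₁ sy) conf c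
    -- A normal form of the reduct at `z` links `G` and `H`, as `z` is independent of both `x` and
    -- `y`.
    ...     | inj₂ third =
              let z , _ , sz , i , j = find third
                  N , N∈ = normalise (DP (var z) F) (MU-step F mu (singular⁺ F z sz))
              in isomorphic-trans G N H (join-independent x z sx sz i G N G∈ N∈)
                   (join-independent z y sz sy (independent-sym {F = F} j) N H N∈ H∈)
    -- Every singular literal conflicts with `x` and with `y`, so both reducts are nonsingular.
    -- Hence they are `G` and `H` themselves, and eventual saturation applies to them.
    ...     | inj₁ all-conflict
      with nonsingular-sDP (DP (var x) F) G nsˣ G∈ | nonsingular-sDP (DP (var y) F) H nsʸ H∈
      where
      conflictˣ : ∀ z → SingularLit F z → Conflicting F x z
      conflictˣ z sz@((C , o) , _) = All.lookup all-conflict (∈-literals C F (main∈ o) (x∈main o)) sz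
      nsˣ = DP-nonsingular F mu x sx (proj₁ (proj₂ conf)) conflictˣ
      nsʸ = DP-nonsingular F mu y sy (proj₂ (proj₂ conf)) λ z sz →
        conflicting-trans {F = F} (proj₁ sx) (conflicting-sym {F = F} conf) (conflictˣ z sz)
    ...       | refl | refl = conflicting⇒isomorphic F mu x y sx sy n conf
                (λ {C} → es (sDP-step F G mu (singular⁺ F x sx) G∈) {C})
                (λ {C} → es (sDP-step F H mu (singular⁺ F y sy) H∈) {C})

  confluent : ∀ n F → Bounded n F → MU F → EventuallySaturated F → Confluent F
  confluent zero F (_ , _ , ()) mu es
  confluent (suc n) F b mu es G H (_ , ns , ε) H∈ with nonsingular-sDP F H ns H∈
  ... | refl = ≈⇒isomorphic F F ((λ {C} C∈ → C∈) , (λ {C} C∈ → C∈))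
  confluent (suc n) F b mu es G H G∈ (_ , ns , ε) with nonsingular-sDP F G ns G∈
  ... | refl = ≈⇒isomorphic F F ((λ {C} C∈ → C∈) , (λ {C} C∈ → C∈))
  confluent (suc n) F b mu es G H (muᴳ , nsᴳ , step {v} _ s ◅ t) (muᴴ , nsᴴ , step {w} _ s′ ◅ t′)
    with singular⁻ F v s | singular⁻ F w s′
  ... | x , refl , sx | y , refl , sy = Join.join F mu es
        (λ v s → confluent n (DP v F) (bounded-step F b s) (MU-step F mu s)
          -- Eventual saturation is inherited, since normal forms of a reduct are normal forms of
          -- `F`.
          λ {F′} F′∈ {C} → es {F′} (sDP-step F F′ mu s F′∈) {C})
        x y sx sy G H (muᴳ , nsᴳ , t) (muᴴ , nsᴴ , t′)

theorem71 : {V : Set} (_≟_ : DecidableEquality V) →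
    let open ClauseSets _≟_ in
    (F : ClauseSet) → MU F → EventuallySaturated F →
    ∀ F′ F″ → F′ ∈sDP F → F″ ∈sDP F → Isomorphic F′ F″
theorem71 _≟_ F = confluent _≟_ _ F (bounded _≟_ F)
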